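{- Let $\mathscr{A}=(\mathscr{C},\mathscr{O})$ be an algebra inherited from the algebra $\mathfrak{G}$ of finite graphs, and let $\varphi$ be a sentence of the counting monadic second-order language of graphs. Then for every $n\in\mathbb{N}$, the set $\{\,G\in\mathscr{C}_n : \models_{\Omega(G)}\varphi\,\}$ is $\mathscr{A}$-recognisable.
   Context: Graphs. $\mathbb{N}$ contains $0$. A graph is $G=(V,E,\langle\_\rangle)$ with $V$ a finite nonempty set of vertices, $E$ a finite set of edges disjoint from $V$, and $\langle\_\rangle:E\to V^*$ assigning to every edge $e$ a nonempty finite word of vertices (its end points); $|e|$ denotes the length of $\langle e\rangle$. (So graphs are hypergraphs; parallel edges and repeated end points are allowed.) A graph of type $n\in\mathbb{N}$ is a graph together with a (not necessarily injective) map $t:\{1,\dots,n\}\to V$; the $t(i)$ are its terminals. $\mathfrak{G}_n$ is the set of graphs of type $n$; names of vertices and edges are immaterial, i.e. two typed graphs are identified if there are bijections of vertices and edges preserving the words $\langle e\rangle$ and the map $t$. Counting monadic second-order language of graphs. Formulas are built with $\neg,\wedge,\forall$ (other connectives and $\exists$ being abbreviations) from individual variables and set variables (unary predicate variables), with atomic formulas $\mathrm{vert}(x)$, $\mathrm{edge}(x)$, $x=y$, $X(x)$, for each $m\in\mathbb{N}$, $\mathrm{conn}_m(y,x_1,\dots,x_m)$, and, for $p\in\mathbb{N}_{>0}$ and $0\le r\le p$, $\mathbf{Card}^p_r(X)$; quantification is over individual variables and set variables. A sentence is a formula without free variables. In the structure $\Omega(G)$ induced by a graph $G$, individual variables range over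 $V\cup E$, set variables range over all subsets of $V$ and all subsets of $E$, $\mathrm{vert}$ and $\mathrm{edge}$ mean membership in $V$ and $E$, $X(x)$ means $x\in X$, $\mathrm{conn}_m(y,x_1,\dots,x_m)$ holds iff $y\in E$ and $\langle y\rangle=x_1\cdots x_m$, and $\mathbf{Card}^p_r(X)$ holds iff $|X|\equiv r \pmod p$. (Terminals are not visible.) $\models_{\Omega(G)}\varphi$ means $\varphi$ is true in $\Omega(G)$. Algebras. A signature $\mathscr{S}=(\mathscr{T},\mathscr{F},\langle\_\rangle)$ consists of a set $\mathscr T$ of sorts, a set $\mathscr F$ of function symbols and a typing $\langle f\rangle=(t_1\cdots t_r,t)\in\mathscr{T}^*\times\mathscr{T}$ for $f\in\mathscr{F}$ ($r$ is the arity, $t$ the output sort). An $\mathscr{S}$-algebra $\mathscr{A}=(\mathscr{C},\mathscr{O})$ consists of disjoint carrier sets $\mathscr{C}_t$ ($t\in\mathscr{T}$) and operations $\mathscr{O}_f:\mathscr{C}_{t_1}\times\dots\times\mathscr{C}_{t_r}\to\mathscr{C}_t$. An $\mathscr{S}$-algebra morphism is a sort-indexed family of maps of carriers commuting with all operations. An algebra is locally finite if each carrier is finite. For $t\in\mathscr T$, a subset $\mathscr{L}\subseteq\mathscr{C}_t$ is $\mathscr{A}$-recognisable if there are a locally finite $\mathscr{S}$-algebra $\mathscr{B}$ with carriers $\mathscr{D}_u$, an $\mathscr{S}$-algebra morphism $h=(h_u)_u:\mathscr{A}\to\mathscr{B}$ and a subset $\mathscr{M}\subseteq\mathscr{D}_t$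 with $\mathscr{L}=h_t^{ -1}(\mathscr{M})$. Inherited algebras. A pre-expression over a signature is a finite nonempty rooted ordered tree with vertices labelled by function symbols such that a vertex labelled $f$ has either no children or exactly as many children as the arity of $f$, in the latter case with the output sorts of the children's labels equal, in order, to the input sorts of $f$. Its input type is the concatenation, over the leaves in traversal order, of the input types of their labels; its output sort is that of the root label. In an algebra it defines, by evaluating from the leaves upward, an operation of this type. The closure $\overline{\mathscr{A}}$ of $\mathscr{A}$ is $\mathscr{A}$ with, for every sort $t$ and every $c\in\mathscr{C}_t$, an additional nullary function symbol of value $c$. The flattening $\mathrm{Fl}(\mathscr{A})$ is $\mathscr{A}$ with, for every pre-expression over its signature, an additional function symbol of the same type whose operation is evaluation of that pre-expression. A subalgebra has the same set of sorts, a subset of the function symbols (with the same typing), subsets of the carriers, and the restricted operations (the carriers being closed under them). $\mathscr{B}$ is inherited from $\mathscr{A}$ if $\mathscr{B}$ is a subalgebra of $\mathrm{Fl}(\overline{\mathscr{A}})$. The algebra $\mathfrak{G}$. Its sorts are the elements of $\mathbb{N}$, its carriers are the $\mathfrak{G}_n$, and its operations are: (i) for all $n,m$, the disjoint sum $\oplus:\mathfrak{G}_n\times\mathfrak{G}_m\to\mathfrak{G}_{n+m}$ (disjoint union, terminals of the first graph followed by those of the second); (ii) for every map $\sigma:\{1,\dots,n\}\to\{1,\dots,m\}$ the terminal redefinition $\mathfrak{G}_m\to\mathfrak{G}_n$, $(G,t)\mapsto(G,t\circ\sigma)$; (iii) for $a,b\in\{1,\dots,n\}$ the fusion $\mathfrak{G}_n\to\mathfrak{G}_n$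 identifying the vertices $t(a)$ and $t(b)$ (all edges kept, words and terminal map transported along the identification; the identity if $t(a)=t(b)$); (iv) the constant $\mathfrak{v}\in\mathfrak{G}_1$ (one vertex, no edges, the vertex is the terminal) and for $n\ge1$ the constant $\mathfrak{e}_n\in\mathfrak{G}_n$ ($n$ distinct vertices $v_1,\dots,v_n$, one edge $e$ with $\langle e\rangle=v_1\cdots v_n$, $t(i)=v_i$). -}

module Defs where

open import Data.Fin.Base using (Fin; zero; suc; _↑ˡ_; _↑ʳ_; join; splitAt; punchIn; punchOut)
open import Data.Fin.Properties
  using (_≟_; splitAt-↑ˡ; splitAt-↑ʳ; splitAt-join; +↔⊎; punchIn-punchOut;
         punchOut-punchIn; punchInᵢ≢i; punchOut-injective; punchOut-cong)
open import Data.Fin.Subset using (Subset; ∣_∣)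
import Data.Fin.Subset as Subset
open import Data.List.Base as List using (List; []; _∷_; _++_)
open import Data.List.NonEmpty.Base as List⁺ using (List⁺; _∷_; toList)
import Data.List.NonEmpty.Properties as List⁺
open import Data.List.Relation.Unary.All as All using (All; []; _∷_)
open import Data.List.Relation.Unary.All.Properties using (++⁻ˡ; ++⁻ʳ)
open import Data.Nat.Base using (ℕ; zero; suc; _+_; _≤_; _%_; NonZero)
open import Data.Product.Base using (Σ; ∃; Σ-syntax; ∃-syntax; _×_; _,_; proj₁; proj₂; map₁)
open import Data.Sum.Base as Sum using (_⊎_; inj₁; inj₂; [_,_]′)
open import Data.Sum.Function.Propositional using (_⊎-↔_)
open import Data.Unit.Polymorphic.Base using (⊤; tt)
open import Data.Empty using (⊥; ⊥-elim)
open import Data.Vec.Base as Vec using (Vec; []; _∷_; lookup)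
open import Function.Base using (_∘_; id)
open import Function.Bundles using (Func; Inverse; _↔_; _⇔_; mk↔ₛ′)
open import Function.Properties.Inverse using (↔-refl; ↔-sym; ↔-trans)
open import Level using (Level; _⊔_; 0ℓ) renaming (suc to lsuc)
open import Relation.Binary.Bundles using (Setoid)
open import Relation.Binary.Definitions using (_Respects_)
import Relation.Binary.Construct.On as On
open import Relation.Binary.PropositionalEquality
  using (_≡_; _≢_; _≗_; refl; sym; trans; cong; cong₂; subst; module ≡-Reasoning)
import Relation.Binary.PropositionalEquality as ≡
open import Relation.Nullary using (¬_; yes; no)
open import Relation.Unary using (Pred)

private variable
  s f c ℓ c′ ℓ′ p q : Level

record Signature (s f : Level) : Set (lsuc (s ⊔ f)) where
  field
    Sort   : Set s
    Symbol : Set f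
    inputs : Symbol → List Sort
    output : Symbol → Sort

Tuple : {T : Set s} → (T → Setoid c ℓ) → List T → Set (s ⊔ c)
Tuple C = All (λ t → Setoid.Carrier (C t))

Pointwise : {T : Set s} (C : T → Setoid c ℓ) {ts : List T} →
            Tuple C ts → Tuple C ts → Set ℓ
Pointwise C []                 []       = ⊤
Pointwise C (_∷_ {x = t} x xs) (y ∷ ys) = Setoid._≈_ (C t) x y × Pointwise C xs ys

-- Carriers are setoids because graphs are only considered up to isomorphism.
-- Being indexed by sorts, carriers of different sorts are disjoint.
record Algebra (S : Signature s f) (c ℓ : Level) : Set (s ⊔ f ⊔ lsuc (c ⊔ ℓ)) where
  open Signature S
  field
    carrier : Sort → Setoid c ℓ

  ∣_∣ₜ : Sort → Set c
  ∣ t ∣ₜ = Setoid.Carrier (carrier t)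

  field
    op      : (g : Symbol) → Tuple carrier (inputs g) → ∣ output g ∣ₜ
    op-cong : (g : Symbol) {xs ys : Tuple carrier (inputs g)} →
              Pointwise carrier xs ys →
              Setoid._≈_ (carrier (output g)) (op g xs) (op g ys)

record Morphism {S : Signature s f} (A : Algebra S c ℓ) (B : Algebra S c′ ℓ′) :
                Set (s ⊔ f ⊔ c ⊔ ℓ ⊔ c′ ⊔ ℓ′) where
  open Signature S
  private
    module A = Algebra A
    module B = Algebra B
  field
    hom : (t : Sort) → Func (A.carrier t) (B.carrier t)

  ⟦_⟧ : {t : Sort} → A.∣ t ∣ₜ → B.∣ t ∣ₜ
  ⟦_⟧ {t} = Func.to (hom t)

  field
    commutes : (g : Symbol) (xs : Tuple A.carrier (inputs g)) →
               Setoid._≈_ (B.carrier (output g))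
                 ⟦ A.op g xs ⟧ (B.op g (All.map ⟦_⟧ xs))

Finite : Setoid c ℓ → Set (c ⊔ ℓ)
Finite X = ∃[ n ] Inverse X (≡.setoid (Fin n))

LocallyFinite : {S : Signature s f} → Algebra S c ℓ → Set (s ⊔ c ⊔ ℓ)
LocallyFinite A = ∀ t → Finite (Algebra.carrier A t)

-- Every locally finite algebra is isomorphic to one with carriers Fin n, so
-- nothing is lost by taking the recognising algebra at level 0ℓ.
Recognisable : {S : Signature s f} (A : Algebra S c ℓ) (t : Signature.Sort S) →
               Pred (Algebra.∣_∣ₜ A t) p → Set (s ⊔ f ⊔ c ⊔ ℓ ⊔ lsuc (0ℓ ⊔ p))
Recognisable {p = p} {S = S} A t L =
  Σ[ B ∈ Algebra S 0ℓ 0ℓ ] LocallyFinite B ×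
  Σ[ h ∈ Morphism A B ]
  Σ[ M ∈ Pred (Algebra.∣_∣ₜ B t) p ]
    (M Respects Setoid._≈_ (Algebra.carrier B t)) ×
    (∀ x → L x ⇔ M (Morphism.⟦_⟧ h x))

module _ (S : Signature s f) where
  open Signature S

  -- A childless vertex labelled by a nullary symbol fits both clauses of the
  -- definition of a pre-expression; requiring the inputs to be nonempty in
  -- node gives it the single representation leaf.
  data PreExpression : Sort → Set (s ⊔ f) where
    leaf : (g : Symbol) → PreExpression (output g)
    node : (g : Symbol) → .(inputs g ≢ []) → All PreExpression (inputs g) →
           PreExpression (output g)

module _ {S : Signature s f} where
  open Signature S

  inputType  : {t : Sort} → PreExpression S t → List Sort
  inputTypes : {ts : List Sort} → All (PreExpression S) ts → List Sort
  inputType (leaf g)      = inputs g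
  inputType (node g _ es) = inputTypes es
  inputTypes []       = []
  inputTypes (e ∷ es) = inputType e ++ inputTypes es

  module _ (A : Algebra S c ℓ) where
    open Algebra A

    eval  : {t : Sort} (e : PreExpression S t) →
            Tuple carrier (inputType e) → ∣ t ∣ₜ
    evals : {ts : List Sort} (es : All (PreExpression S) ts) →
            Tuple carrier (inputTypes es) → Tuple carrier ts
    eval (leaf g)      xs = op g xs
    eval (node g _ es) xs = op g (evals es xs)
    evals []       xs = []
    evals (e ∷ es) xs = eval e (++⁻ˡ (inputType e) xs)
                      ∷ evals es (++⁻ʳ (inputType e) xs)

    private
      split-cong : (ts : List Sort) {us : List Sort} {xs ys : Tuple carrier (ts ++ us)} →
                   Pointwise carrier xs ys →
                   Pointwise carrier (++⁻ˡ ts xs) (++⁻ˡ ts ys) ×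
                   Pointwise carrier (++⁻ʳ ts xs) (++⁻ʳ ts ys)
      split-cong []                                 r       = tt , r
      split-cong (t ∷ ts) {xs = _ ∷ _} {ys = _ ∷ _} (e , r) = map₁ (e ,_) (split-cong ts r)

    eval-cong  : {t : Sort} (e : PreExpression S t) {xs ys : Tuple carrier (inputType e)} →
                 Pointwise carrier xs ys →
                 Setoid._≈_ (carrier t) (eval e xs) (eval e ys)
    evals-cong : {ts : List Sort} (es : All (PreExpression S) ts)
                 {xs ys : Tuple carrier (inputTypes es)} →
                 Pointwise carrier xs ys →
                 Pointwise carrier (evals es xs) (evals es ys)
    eval-cong (leaf g)      r = op-cong g r
    eval-cong (node g _ es) r = op-cong g (evals-cong es r)
    evals-cong []       r = tt
    evals-cong (e ∷ es) r = eval-cong e (proj₁ (split-cong (inputType e) r))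
                          , evals-cong es (proj₂ (split-cong (inputType e) r))

flattenSignature : Signature s f → Signature s (s ⊔ f)
flattenSignature S = record
  { Sort   = Sort
  ; Symbol = Symbol ⊎ ∃ (PreExpression S)
  ; inputs = [ inputs , inputType ∘ proj₂ ]′
  ; output = [ output , proj₁ ]′
  } where open Signature S

Fl : {S : Signature s f} → Algebra S c ℓ → Algebra (flattenSignature S) c ℓ
Fl A = record
  { carrier = carrier
  ; op      = λ { (inj₁ g) → op g      ; (inj₂ (_ , e)) → eval A e }
  ; op-cong = λ { (inj₁ g) → op-cong g ; (inj₂ (_ , e)) → eval-cong A e }
  } where open Algebra A

-- A constant is added for every representative of an element of a carrier;
-- equal representatives give constants of equal value.
closureSignature : {S : Signature s f} → Algebra S c ℓ → Signature s (s ⊔ f ⊔ c)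
closureSignature {S = S} A = record
  { Sort   = Sort
  ; Symbol = Symbol ⊎ ∃ (Algebra.∣_∣ₜ A)
  ; inputs = [ inputs , (λ _ → []) ]′
  ; output = [ output , proj₁ ]′
  } where open Signature S

closure : {S : Signature s f} (A : Algebra S c ℓ) → Algebra (closureSignature A) c ℓ
closure A = record
  { carrier = carrier
  ; op      = λ { (inj₁ g) → op g      ; (inj₂ (_ , x)) _ → x }
  ; op-cong = λ { (inj₁ g) → op-cong g ; (inj₂ (t , _)) _ → Setoid.refl (carrier t) }
  } where open Algebra A

record Subalgebra {S : Signature s f} (A : Algebra S c ℓ) (p q : Level) :
                  Set (s ⊔ f ⊔ c ⊔ ℓ ⊔ lsuc (p ⊔ q)) where
  open Signature S
  open Algebra A
  field
    Symbols  : Pred Symbol p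
    Members  : (t : Sort) → Pred ∣ t ∣ₜ q
    respects : (t : Sort) → Members t Respects Setoid._≈_ (carrier t)
    closed   : (g : Symbol) → Symbols g →
               (xs : All (λ t → ∃ (Members t)) (inputs g)) →
               Members (output g) (op g (All.map proj₁ xs))

  signature : Signature s (f ⊔ p)
  signature = record
    { Sort   = Sort
    ; Symbol = ∃ Symbols
    ; inputs = inputs ∘ proj₁
    ; output = output ∘ proj₁
    }

  private
    sub : Sort → Setoid (c ⊔ q) ℓ
    sub t = On.setoid {B = ∃ (Members t)} (carrier t) proj₁

    forget-cong : {ts : List Sort} {xs ys : Tuple sub ts} → Pointwise sub xs ys →
                  Pointwise carrier (All.map proj₁ xs) (All.map proj₁ ys)
    forget-cong {xs = []}    {ys = []}    _       = tt
    forget-cong {xs = _ ∷ _} {ys = _ ∷ _} (e , r) = e , forget-cong r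

  algebra : Algebra signature (c ⊔ q) ℓ
  algebra = record
    { carrier = sub
    ; op      = λ (g , g∈) xs → op g (All.map proj₁ xs) , closed g g∈ xs
    ; op-cong = λ (g , _) r → op-cong g (forget-cong r)
    }

InheritedFrom : {S : Signature s f} (A : Algebra S c ℓ) (p q : Level) →
                Set (s ⊔ f ⊔ c ⊔ ℓ ⊔ lsuc (p ⊔ q))
InheritedFrom A p q = Subalgebra (Fl (closure A)) p q

-- The names of vertices and edges are immaterial, so both sets are taken to
-- be of the form Fin k; there are suc order-1 vertices, hence at least one.
record Graph : Set where
  field
    order-1 : ℕ
    size    : ℕ

  V : Set
  V = Fin (suc order-1)

  E : Set
  E = Fin size

  field
    ⟨_⟩ : E → List⁺ V

record TypedGraph (n : ℕ) : Set where
  field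
    graph : Graph
  open Graph graph public
  field
    terminal : Fin n → V

infix 4 _≅_

record _≅_ {n : ℕ} (G H : TypedGraph n) : Set where
  private
    module G = TypedGraph G
    module H = TypedGraph H
  field
    vertices : G.V ↔ H.V
    edges    : G.E ↔ H.E
  private
    module V = Inverse vertices
    module E = Inverse edges
  field
    words     : ∀ e → List⁺.map V.to G.⟨ e ⟩ ≡ H.⟨ E.to e ⟩
    terminals : ∀ i → V.to (G.terminal i) ≡ H.terminal i

private variable
  n m : ℕ

≅-refl : {G : TypedGraph n} → G ≅ G
≅-refl = record
  { vertices = ↔-refl ; edges = ↔-refl ; words = λ e → List⁺.map-id _ ; terminals = λ _ → refl }

≅-sym : {G H : TypedGraph n} → G ≅ H → H ≅ G
≅-sym {G = G} {H} φ = record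
  { vertices  = ↔-sym vertices
  ; edges     = ↔-sym edges
  ; words     = λ e → begin
      List⁺.map V.from H.⟨ e ⟩
        ≡⟨ cong (λ e → List⁺.map V.from H.⟨ e ⟩) (E.strictlyInverseˡ e) ⟨
      List⁺.map V.from H.⟨ E.to (E.from e) ⟩
        ≡⟨ cong (List⁺.map V.from) (words (E.from e)) ⟨
      List⁺.map V.from (List⁺.map V.to G.⟨ E.from e ⟩)
        ≡⟨ List⁺.map-∘ G.⟨ E.from e ⟩ ⟨
      List⁺.map (V.from ∘ V.to) G.⟨ E.from e ⟩
        ≡⟨ List⁺.map-cong V.strictlyInverseʳ G.⟨ E.from e ⟩ ⟩
      List⁺.map id G.⟨ E.from e ⟩
        ≡⟨ List⁺.map-id _ ⟩
      G.⟨ E.from e ⟩ ∎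
  ; terminals = λ i → V.inverseʳ (sym (terminals i))
  }
  where
  open _≅_ φ
  open ≡-Reasoning
  module G = TypedGraph G
  module H = TypedGraph H
  module V = Inverse vertices
  module E = Inverse edges

≅-trans : {G H K : TypedGraph n} → G ≅ H → H ≅ K → G ≅ K
≅-trans {G = G} φ ψ = record
  { vertices  = ↔-trans φ.vertices ψ.vertices
  ; edges     = ↔-trans φ.edges ψ.edges
  ; words     = λ e → trans (List⁺.map-∘ (TypedGraph.⟨_⟩ G e))
                        (trans (cong (List⁺.map (Inverse.to ψ.vertices)) (φ.words e))
                               (ψ.words (Inverse.to φ.edges e)))
  ; terminals = λ i → trans (cong (Inverse.to ψ.vertices) (φ.terminals i)) (ψ.terminals i)
  }
  where
  module φ = _≅_ φ
  module ψ = _≅_ ψ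

graphSetoid : ℕ → Setoid 0ℓ 0ℓ
graphSetoid n = record
  { Carrier       = TypedGraph n
  ; _≈_           = _≅_
  ; isEquivalence = record { refl = ≅-refl ; sym = ≅-sym ; trans = ≅-trans }
  }

infixr 6 _⊕_

_⊕_ : TypedGraph n → TypedGraph m → TypedGraph (n + m)
_⊕_ {n} {m} G H = record
  { graph = record
      { order-1 = G.order-1 + suc H.order-1
      ; size    = G.size + H.size
      ; ⟨_⟩     = λ e → [ (λ d → List⁺.map left  G.⟨ d ⟩)
                        , (λ d → List⁺.map right H.⟨ d ⟩) ]′ (splitAt G.size e)
      }
  ; terminal = λ i → [ left ∘ G.terminal , right ∘ H.terminal ]′ (splitAt n i)
  }
  where
  module G = TypedGraph G
  module H = TypedGraph H
  left : G.V → Fin (suc G.order-1 + suc H.order-1)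
  left x = x ↑ˡ suc H.order-1
  right : H.V → Fin (suc G.order-1 + suc H.order-1)
  right y = suc G.order-1 ↑ʳ y

redefine : (Fin n → Fin m) → TypedGraph m → TypedGraph n
redefine σ G = record { graph = graph ; terminal = terminal ∘ σ } where open TypedGraph G

-- A quotient of Fin (suc k) by the equivalence relation generated by the
-- single pair (i , j).
record Identification {k : ℕ} (i j : Fin (suc k)) : Set where
  field
    k′         : ℕ
    π          : Fin (suc k) → Fin (suc k′)
    section    : Fin (suc k′) → Fin (suc k)
    π-section  : ∀ x → π (section x) ≡ x
    identifies : π i ≡ π j
    separates  : ∀ x y → π x ≡ π y → x ≡ y ⊎ (x ≡ i × y ≡ j) ⊎ (x ≡ j × y ≡ i)

identify : {k : ℕ} (i j : Fin (suc k)) → Identification i j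
identify {k} i j with i ≟ j
identify {k} i j | yes i≡j = record
  { k′ = k ; π = id ; section = id ; π-section = λ _ → refl
  ; identifies = i≡j ; separates = λ _ _ → inj₁ }
identify {zero}  zero zero | no i≢j = ⊥-elim (i≢j refl)
identify {suc k} i    j    | no i≢j = record
  { k′         = k
  ; π          = π
  ; section    = punchIn j
  ; π-section  = π-section
  ; identifies = identifies
  ; separates  = separates
  }
  where
  j≢i : j ≢ i
  j≢i = i≢j ∘ sym

  π : Fin (suc (suc k)) → Fin (suc k)
  π x with j ≟ x
  ... | yes _  = punchOut j≢i
  ... | no j≢x = punchOut j≢x

  π-section : ∀ x → π (punchIn j x) ≡ x
  π-section x with j ≟ punchIn j x
  ... | yes j≡x = ⊥-elim (punchInᵢ≢i j x (sym j≡x))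
  ... | no  j≢x = trans (punchOut-cong j refl) (punchOut-punchIn j)

  identifies : π i ≡ π j
  identifies with j ≟ i | j ≟ j
  ... | yes j≡i | _      = ⊥-elim (j≢i j≡i)
  ... | no _    | yes _  = punchOut-cong j refl
  ... | no _    | no j≢j = ⊥-elim (j≢j refl)

  separates : ∀ x y → π x ≡ π y → x ≡ y ⊎ (x ≡ i × y ≡ j) ⊎ (x ≡ j × y ≡ i)
  separates x y πx≡πy with j ≟ x | j ≟ y
  ... | yes j≡x | yes j≡y = inj₁ (trans (sym j≡x) j≡y)
  ... | yes j≡x | no  j≢y = inj₂ (inj₂ (sym j≡x , sym (punchOut-injective j≢i j≢y πx≡πy)))
  ... | no  j≢x | yes j≡y = inj₂ (inj₁ (punchOut-injective j≢x j≢i πx≡πy , sym j≡y))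
  ... | no  j≢x | no  j≢y = inj₁ (punchOut-injective j≢x j≢y πx≡πy)

fuse : (a b : Fin n) → TypedGraph n → TypedGraph n
fuse a b G = record
  { graph    = record { order-1 = k′ ; size = size ; ⟨_⟩ = List⁺.map π ∘ ⟨_⟩ }
  ; terminal = π ∘ terminal
  }
  where
  open TypedGraph G
  open Identification (identify (terminal a) (terminal b))

𝔳 : TypedGraph 1
𝔳 = record
  { graph    = record { order-1 = 0 ; size = 0 ; ⟨_⟩ = λ () }
  ; terminal = id
  }

-- Indexed by the number of terminals minus one, as 𝔢 needs at least one.
𝔢 : (k : ℕ) → TypedGraph (suc k)
𝔢 k = record
  { graph    = record { order-1 = k ; size = 1 ; ⟨_⟩ = λ _ → zero ∷ List.tabulate suc }
  ; terminal = id
  }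

⊕-cong : {G G′ : TypedGraph n} {H H′ : TypedGraph m} → G ≅ G′ → H ≅ H′ → G ⊕ H ≅ G′ ⊕ H′
⊕-cong {n} {m} {G} {G′} {H} {H′} φ ψ = record
  { vertices = vs ; edges = es ; words = ws ; terminals = ts }
  where
  module φ = _≅_ φ
  module ψ = _≅_ ψ
  module G = TypedGraph G
  module H = TypedGraph H
  module G′ = TypedGraph G′
  module H′ = TypedGraph H′
  vs : TypedGraph.V (G ⊕ H) ↔ TypedGraph.V (G′ ⊕ H′)
  vs = ↔-trans (+↔⊎ {suc G.order-1}) (↔-trans (φ.vertices ⊎-↔ ψ.vertices) (↔-sym +↔⊎))
  es : TypedGraph.E (G ⊕ H) ↔ TypedGraph.E (G′ ⊕ H′)
  es = ↔-trans (+↔⊎ {G.size}) (↔-trans (φ.edges ⊎-↔ ψ.edges) (↔-sym +↔⊎))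

  left : ∀ x → Inverse.to vs (x ↑ˡ suc H.order-1)
             ≡ Inverse.to φ.vertices x ↑ˡ suc H′.order-1
  left x = cong (join (suc G′.order-1) (suc H′.order-1)
                 ∘ Sum.map (Inverse.to φ.vertices) (Inverse.to ψ.vertices))
                (splitAt-↑ˡ (suc G.order-1) x (suc H.order-1))
  right : ∀ y → Inverse.to vs (suc G.order-1 ↑ʳ y)
              ≡ suc G′.order-1 ↑ʳ Inverse.to ψ.vertices y
  right y = cong (join (suc G′.order-1) (suc H′.order-1)
                  ∘ Sum.map (Inverse.to φ.vertices) (Inverse.to ψ.vertices))
                 (splitAt-↑ʳ (suc G.order-1) (suc H.order-1) y)

  word⊕ : (G′.E ⊎ H′.E) → List⁺ (TypedGraph.V (G′ ⊕ H′))
  word⊕ = [ (λ d → List⁺.map (_↑ˡ suc H′.order-1) G′.⟨ d ⟩)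
          , (λ d → List⁺.map (suc G′.order-1 ↑ʳ_) H′.⟨ d ⟩) ]′

  open ≡-Reasoning

  ws : ∀ e → List⁺.map (Inverse.to vs) (TypedGraph.⟨_⟩ (G ⊕ H) e)
           ≡ TypedGraph.⟨_⟩ (G′ ⊕ H′) (Inverse.to es e)
  ws e = trans (lemma (splitAt G.size e))
           (cong word⊕ (sym (splitAt-join G′.size H′.size
             (Sum.map (Inverse.to φ.edges) (Inverse.to ψ.edges) (splitAt G.size e)))))
    where
    lemma : ∀ d → List⁺.map (Inverse.to vs)
                    ([ (λ d → List⁺.map (_↑ˡ suc H.order-1) G.⟨ d ⟩)
                     , (λ d → List⁺.map (suc G.order-1 ↑ʳ_) H.⟨ d ⟩) ]′ d)
                ≡ word⊕ (Sum.map (Inverse.to φ.edges) (Inverse.to ψ.edges) d)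
    lemma (inj₁ d) = begin
      List⁺.map (Inverse.to vs) (List⁺.map (_↑ˡ suc H.order-1) G.⟨ d ⟩)
        ≡⟨ List⁺.map-∘ G.⟨ d ⟩ ⟨
      List⁺.map (Inverse.to vs ∘ (_↑ˡ suc H.order-1)) G.⟨ d ⟩
        ≡⟨ List⁺.map-cong left G.⟨ d ⟩ ⟩
      List⁺.map ((_↑ˡ suc H′.order-1) ∘ Inverse.to φ.vertices) G.⟨ d ⟩
        ≡⟨ List⁺.map-∘ G.⟨ d ⟩ ⟩
      List⁺.map (_↑ˡ suc H′.order-1) (List⁺.map (Inverse.to φ.vertices) G.⟨ d ⟩)
        ≡⟨ cong (List⁺.map (_↑ˡ suc H′.order-1)) (φ.words d) ⟩
      List⁺.map (_↑ˡ suc H′.order-1) G′.⟨ Inverse.to φ.edges d ⟩ ∎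
    lemma (inj₂ d) = begin
      List⁺.map (Inverse.to vs) (List⁺.map (suc G.order-1 ↑ʳ_) H.⟨ d ⟩)
        ≡⟨ List⁺.map-∘ H.⟨ d ⟩ ⟨
      List⁺.map (Inverse.to vs ∘ (suc G.order-1 ↑ʳ_)) H.⟨ d ⟩
        ≡⟨ List⁺.map-cong right H.⟨ d ⟩ ⟩
      List⁺.map ((suc G′.order-1 ↑ʳ_) ∘ Inverse.to ψ.vertices) H.⟨ d ⟩
        ≡⟨ List⁺.map-∘ H.⟨ d ⟩ ⟩
      List⁺.map (suc G′.order-1 ↑ʳ_) (List⁺.map (Inverse.to ψ.vertices) H.⟨ d ⟩)
        ≡⟨ cong (List⁺.map (suc G′.order-1 ↑ʳ_)) (ψ.words d) ⟩
      List⁺.map (suc G′.order-1 ↑ʳ_) H′.⟨ Inverse.to ψ.edges d ⟩ ∎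

  ts : ∀ i → Inverse.to vs (TypedGraph.terminal (G ⊕ H) i) ≡ TypedGraph.terminal (G′ ⊕ H′) i
  ts i with splitAt n i
  ... | inj₁ a = trans (left  (G.terminal a)) (cong (_↑ˡ suc H′.order-1) (φ.terminals a))
  ... | inj₂ b = trans (right (H.terminal b)) (cong (suc G′.order-1 ↑ʳ_) (ψ.terminals b))

redefine-cong : (σ : Fin n → Fin m) {G H : TypedGraph m} → G ≅ H → redefine σ G ≅ redefine σ H
redefine-cong σ φ = record
  { vertices = vertices ; edges = edges ; words = words ; terminals = terminals ∘ σ }
  where open _≅_ φ

fuse-cong : (a b : Fin n) {G H : TypedGraph n} → G ≅ H → fuse a b G ≅ fuse a b H
fuse-cong a b {G} {H} φ = record
  { vertices  = mk↔ₛ′ to from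
      (λ y → trans (to-π _) (trans (cong H.π (V.strictlyInverseˡ _)) (H.π-section y)))
      (λ x → trans (from-π _) (trans (cong G.π (V.strictlyInverseʳ _)) (G.π-section x)))
  ; edges     = edges
  ; words     = λ e → begin
      List⁺.map to (List⁺.map G.π G.⟨ e ⟩)   ≡⟨ List⁺.map-∘ G.⟨ e ⟩ ⟨
      List⁺.map (to ∘ G.π) G.⟨ e ⟩           ≡⟨ List⁺.map-cong to-π G.⟨ e ⟩ ⟩
      List⁺.map (H.π ∘ V.to) G.⟨ e ⟩         ≡⟨ List⁺.map-∘ G.⟨ e ⟩ ⟩
      List⁺.map H.π (List⁺.map V.to G.⟨ e ⟩) ≡⟨ cong (List⁺.map H.π) (words e) ⟩
      List⁺.map H.π H.⟨ Inverse.to edges e ⟩ ∎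
  ; terminals = λ i → trans (to-π (G.terminal i)) (cong H.π (terminals i))
  }
  where
  open _≅_ φ
  open ≡-Reasoning
  module V = Inverse vertices
  module G where
    open TypedGraph G public
    open Identification (identify (terminal a) (terminal b)) public
  module H where
    open TypedGraph H public
    open Identification (identify (terminal a) (terminal b)) public

  to : Fin (suc G.k′) → Fin (suc H.k′)
  to = H.π ∘ V.to ∘ G.section
  from : Fin (suc H.k′) → Fin (suc G.k′)
  from = G.π ∘ V.from ∘ H.section

  preserves : ∀ x y → G.π x ≡ G.π y → H.π (V.to x) ≡ H.π (V.to y)
  preserves x y eq with G.separates x y eq
  ... | inj₁ refl = refl
  ... | inj₂ (inj₁ (refl , refl)) =
    trans (cong H.π (terminals a)) (trans H.identifies (cong H.π (sym (terminals b))))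
  ... | inj₂ (inj₂ (refl , refl)) =
    trans (cong H.π (terminals b)) (trans (sym H.identifies) (cong H.π (sym (terminals a))))

  reflects : ∀ x y → H.π x ≡ H.π y → G.π (V.from x) ≡ G.π (V.from y)
  reflects x y eq with H.separates x y eq
  ... | inj₁ refl = refl
  ... | inj₂ (inj₁ (refl , refl)) =
    trans (cong G.π (V.inverseʳ (sym (terminals a))))
      (trans G.identifies (cong G.π (sym (V.inverseʳ (sym (terminals b))))))
  ... | inj₂ (inj₂ (refl , refl)) =
    trans (cong G.π (V.inverseʳ (sym (terminals b))))
      (trans (sym G.identifies) (cong G.π (sym (V.inverseʳ (sym (terminals a))))))

  to-π : ∀ x → to (G.π x) ≡ H.π (V.to x)
  to-π x = preserves _ x (G.π-section (G.π x))

  from-π : ∀ y → from (H.π y) ≡ G.π (V.from y)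
  from-π y = reflects _ y (H.π-section (H.π y))

data GraphSymbol : Set where
  sumₛ      : (n m : ℕ) → GraphSymbol
  redefineₛ : {n m : ℕ} → (Fin n → Fin m) → GraphSymbol
  fuseₛ     : {n : ℕ} → Fin n → Fin n → GraphSymbol
  vertexₛ   : GraphSymbol
  edgeₛ     : ℕ → GraphSymbol

graphInputs : GraphSymbol → List ℕ
graphInputs (sumₛ n m)            = n ∷ m ∷ []
graphInputs (redefineₛ {n} {m} _) = m ∷ []
graphInputs (fuseₛ {n} _ _)       = n ∷ []
graphInputs vertexₛ               = []
graphInputs (edgeₛ _)             = []

graphOutput : GraphSymbol → ℕ
graphOutput (sumₛ n m)            = n + m
graphOutput (redefineₛ {n} {m} _) = n
graphOutput (fuseₛ {n} _ _)       = n
graphOutput vertexₛ               = 1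
graphOutput (edgeₛ k)             = suc k

graphSignature : Signature 0ℓ 0ℓ
graphSignature = record
  { Sort = ℕ ; Symbol = GraphSymbol ; inputs = graphInputs ; output = graphOutput }

graphOp : (g : GraphSymbol) → Tuple graphSetoid (graphInputs g) → TypedGraph (graphOutput g)
graphOp (sumₛ _ _)    (G ∷ H ∷ []) = G ⊕ H
graphOp (redefineₛ σ) (G ∷ [])     = redefine σ G
graphOp (fuseₛ a b)   (G ∷ [])     = fuse a b G
graphOp vertexₛ       []           = 𝔳
graphOp (edgeₛ k)     []           = 𝔢 k

graphOp-cong : (g : GraphSymbol) {Gs Hs : Tuple graphSetoid (graphInputs g)} →
               Pointwise graphSetoid Gs Hs → graphOp g Gs ≅ graphOp g Hs
graphOp-cong (sumₛ _ _)    {_ ∷ _ ∷ []} {_ ∷ _ ∷ []} (φ , ψ , _) = ⊕-cong φ ψ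
graphOp-cong (redefineₛ σ) {_ ∷ []}     {_ ∷ []}     (φ , _)     = redefine-cong σ φ
graphOp-cong (fuseₛ a b)   {_ ∷ []}     {_ ∷ []}     (φ , _)     = fuse-cong a b φ
graphOp-cong vertexₛ       {[]}         {[]}         _           = ≅-refl
graphOp-cong (edgeₛ k)     {[]}         {[]}         _           = ≅-refl

𝔊 : Algebra graphSignature 0ℓ 0ℓ
𝔊 = record { carrier = graphSetoid ; op = graphOp ; op-cong = graphOp-cong }

-- Formula i s has free individual variables among Fin i and free set
-- variables among Fin s; a quantifier binds variable zero.
data Formula : (i s : ℕ) → Set where
  vert    : ∀ {i s} → Fin i → Formula i s
  edge    : ∀ {i s} → Fin i → Formula i s
  _≐_     : ∀ {i s} → Fin i → Fin i → Formula i s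
  _∋_     : ∀ {i s} → Fin s → Fin i → Formula i s
  conn    : ∀ {i s} (m : ℕ) → Fin i → Vec (Fin i) m → Formula i s
  Card    : ∀ {i s} (p : ℕ) .{{_ : NonZero p}} (r : ℕ) → .(r ≤ p) → Fin s → Formula i s
  ¬′_     : ∀ {i s} → Formula i s → Formula i s
  _∧′_    : ∀ {i s} → Formula i s → Formula i s → Formula i s
  ∀-ind   : ∀ {i s} → Formula (suc i) s → Formula i s
  ∀-set   : ∀ {i s} → Formula i (suc s) → Formula i s

Sentence : Set
Sentence = Formula 0 0

-- A set variable ranges over all subsets of V and all subsets of E, but not over
-- mixed subsets of V ⊎ E.
module Ω (G : Graph) where
  open Graph G

  Element : Set
  Element = V ⊎ E

  SetElement : Set
  SetElement = Subset (suc order-1) ⊎ Subset size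

  _∈_ : Element → SetElement → Set
  inj₁ v ∈ inj₁ X = v Subset.∈ X
  inj₂ e ∈ inj₂ X = e Subset.∈ X
  inj₁ _ ∈ inj₂ _ = ⊥
  inj₂ _ ∈ inj₁ _ = ⊥

  card : SetElement → ℕ
  card = [ ∣_∣ , ∣_∣ ]′

  Sat : ∀ {i s} → Formula i s → Vec Element i → Vec SetElement s → Set
  Sat (vert x)       ρ σ = ∃[ v ] lookup ρ x ≡ inj₁ v
  Sat (edge x)       ρ σ = ∃[ e ] lookup ρ x ≡ inj₂ e
  Sat (x ≐ y)        ρ σ = lookup ρ x ≡ lookup ρ y
  Sat (X ∋ x)        ρ σ = lookup ρ x ∈ lookup σ X
  Sat (conn m y xs)  ρ σ = ∃[ e ] lookup ρ y ≡ inj₂ e ×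
                           List.map inj₁ (toList ⟨ e ⟩) ≡ Vec.toList (Vec.map (lookup ρ) xs)
  Sat (Card p r _ X) ρ σ = card (lookup σ X) % p ≡ r % p
  Sat (¬′ φ)         ρ σ = ¬ Sat φ ρ σ
  Sat (φ ∧′ ψ)       ρ σ = Sat φ ρ σ × Sat ψ ρ σ
  Sat (∀-ind φ)      ρ σ = (x : Element) → Sat φ (x ∷ ρ) σ
  Sat (∀-set φ)      ρ σ = (X : SetElement) → Sat φ ρ (X ∷ σ)

⊨Ω : Graph → Sentence → Set
⊨Ω G φ = Ω.Sat G φ [] []

{-# OPTIONS --safe #-}

-- A set variable of the fused graph is a set variable of the original graph which agrees on
-- the two fused terminals, and a set variable of a disjoint sum is a pair of set variables.
-- Hence, if finitely many states describe how a formula with a free set variable behaves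
-- under the operations, so do sets of states, paired with the colours of the terminals, for
-- its quantification. Individual variables are represented by singletons. Among the atomic
-- formulas only the cardinality predicates are affected by a fusion, which loses an element
-- of a set containing two distinct fused terminals. Only finitely many states exist for each
-- sort, so they form a locally finite algebra over the signature of 𝔊; it is expanded to the
-- signature of an inherited algebra by evaluating pre-expressions, the constants of the
-- closure being interpreted by their images.
module Submission where

open import Defs
open import Data.Bool.Base using (Bool; true; false; not; _∧_; _∨_; if_then_else_)
open import Data.Bool.Properties using (not-injective; ¬-not) renaming (_≟_ to _≟ᴮ_)
open import Data.Empty using (⊥)
open import Data.Fin.Base using (Fin; zero; suc; toℕ; _↑ˡ_; _↑ʳ_; splitAt; punchIn; punchOut)
import Data.Fin.Properties as Fin
open import Data.Fin.Properties
  using (*↔×; 2↔Bool; splitAt-↑ˡ; splitAt-↑ʳ; splitAt⁻¹-↑ˡ; splitAt⁻¹-↑ʳ;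
         ↑ˡ-injective; ↑ʳ-injective)
open import Data.Fin.Subset using (Subset; ∣_∣)
open import Data.Fin.Subset.Properties using (anySubset?)
open import Data.List.Base as List using (List; []; _∷_; _++_)
open import Data.List.NonEmpty.Base as List⁺ using (List⁺; toList)
import Data.List.Properties as List
open import Data.List.Relation.Unary.All as All using (All; []; _∷_)
open import Data.List.Relation.Unary.All.Properties using (++⁻ˡ; ++⁻ʳ; map-∘)
open import Data.Maybe.Base using (Maybe; just; nothing; maybe′)
open import Data.Nat.Base using (ℕ; zero; suc; _+_; _%_; NonZero; pred)
open import Data.Nat.DivMod using (_mod_; m%n<n; %-distribˡ-+; m%n%n≡m%n; [m+n]%n≡m%n)
import Data.Nat.Properties as ℕ
open import Algebra.Properties.CommutativeMonoid.Sum ℕ.+-0-commutativeMonoid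
  using (sum; sum-cong-≗; sum-permute; sum-remove; sum-replicate-zero)
open import Algebra.Properties.CommutativeSemigroup ℕ.+-commutativeSemigroup
  using () renaming (interchange to +-interchange)
open import Data.Product.Base using (∃; ∃-syntax; _×_; _,_; proj₁; proj₂)
open import Data.Product.Function.NonDependent.Propositional using (_×-↔_; _×-⇔_)
open import Data.Sum.Base as Sum using (_⊎_; inj₁; inj₂; [_,_]′)
open import Data.Sum.Properties using (≡-dec)
open import Data.Unit.Polymorphic.Base using (tt)
open import Data.Vec.Base as Vec using (Vec; []; _∷_; lookup; tabulate)
open import Data.Vec.Properties using (lookup∘tabulate; tabulate-cong; []=⇒lookup; lookup⇒[]=)
open import Function.Base using (_∘_; id)
open import Function.Bundles
  using (Func; Injection; Inverse; Equivalence; _↔_; _⇔_; mk⇔; mk↔ₛ′)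
open import Function.Properties.Equivalence
  using () renaming (refl to ⇔-refl; sym to ⇔-sym; trans to ⇔-trans)
open import Function.Properties.Inverse using (↔-refl; ↔-sym; ↔-trans; ↔⇒↣)
open import Level using (Level)
open import Relation.Binary.Bundles using (Setoid)
open import Relation.Binary.PropositionalEquality
  using (_≡_; _≢_; _≗_; refl; sym; trans; cong; cong₂; subst; setoid; module ≡-Reasoning)
open import Relation.Nullary.Decidable
  using (Dec; yes; no; does; dec-true; dec-false; does-⇔; decidable-stable; map′;
         _×-dec_; _⊎-dec_)
open import Relation.Nullary.Negation using (¬_; contradiction)
open import Relation.Unary using (Pred)

open Equivalence using (to; from)

private variable
  s f c ℓ c′ ℓ′ p q r : Level
  A B K K′ : Set
  i j m n : ℕ

-- Pre-expressions, morphisms and inherited algebras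

pointwise-reflexive : {T : Set s} (C : T → Setoid c ℓ) {ts : List T} {xs ys : Tuple C ts} →
                      xs ≡ ys → Pointwise C xs ys
pointwise-reflexive C {xs = []}    refl = tt
pointwise-reflexive C {xs = _ ∷ _} refl = Setoid.refl (C _) , pointwise-reflexive C refl

pointwise-trans : {T : Set s} (C : T → Setoid c ℓ) {ts : List T} {xs ys zs : Tuple C ts} →
                  Pointwise C xs ys → Pointwise C ys zs → Pointwise C xs zs
pointwise-trans C {xs = []}    {[]}    {[]}    _        _        = tt
pointwise-trans C {xs = _ ∷ _} {_ ∷ _} {_ ∷ _} (e , es) (d , ds) =
  Setoid.trans (C _) e d , pointwise-trans C es ds

module _ {a p q} {A : Set a} {P : Pred A p} {Q : Pred A q} (g : ∀ {x} → P x → Q x) where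

  ++⁻ˡ-map : (xs : List A) {ys : List A} (ps : All P (xs ++ ys)) →
             All.map g (++⁻ˡ xs ps) ≡ ++⁻ˡ xs (All.map g ps)
  ++⁻ˡ-map []       ps       = refl
  ++⁻ˡ-map (x ∷ xs) (p ∷ ps) = cong (g p ∷_) (++⁻ˡ-map xs ps)

  ++⁻ʳ-map : (xs : List A) {ys : List A} (ps : All P (xs ++ ys)) →
             All.map g (++⁻ʳ xs ps) ≡ ++⁻ʳ xs (All.map g ps)
  ++⁻ʳ-map []       ps       = refl
  ++⁻ʳ-map (x ∷ xs) (p ∷ ps) = ++⁻ʳ-map xs ps

module _ {S : Signature s f} {A : Algebra S c ℓ} {B : Algebra S c′ ℓ′} (h : Morphism A B) where
  private
    module A = Algebra A
    module B = Algebra B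
  open Morphism h

  -- By mutual induction over the tree: `commutes` moves the morphism past the root label and
  -- `op-cong` carries the agreement of the children upward. Each child reads its own segment of the
  -- argument tuple, so cutting out segments must also commute with mapping.
  eval-commutes  : ∀ {t} (e : PreExpression S t) (xs : Tuple A.carrier (inputType e)) →
                   Setoid._≈_ (B.carrier t) ⟦ eval A e xs ⟧ (eval B e (All.map ⟦_⟧ xs))
  evals-commutes : ∀ {ts} (es : All (PreExpression S) ts) (xs : Tuple A.carrier (inputTypes es)) →
                   Pointwise B.carrier (All.map ⟦_⟧ (evals A es xs)) (evals B es (All.map ⟦_⟧ xs))
  eval-commutes (leaf g)      xs = commutes g xs
  eval-commutes (node g _ es) xs =
    Setoid.trans (B.carrier _) (commutes g (evals A es xs)) (B.op-cong g (evals-commutes es xs))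
  evals-commutes []       xs = tt
  evals-commutes (e ∷ es) xs =
    Setoid.trans (B.carrier _)
      (eval-commutes e (++⁻ˡ (inputType e) xs))
      (eval-cong B e (pointwise-reflexive B.carrier (++⁻ˡ-map ⟦_⟧ (inputType e) xs))) ,
    pointwise-trans B.carrier
      (evals-commutes es (++⁻ʳ (inputType e) xs))
      (evals-cong B es (pointwise-reflexive B.carrier (++⁻ʳ-map ⟦_⟧ (inputType e) xs)))

  Fl-morphism : Morphism (Fl A) (Fl B)
  Fl-morphism = record
    { hom      = hom
    ; commutes = λ { (inj₁ g) → commutes g ; (inj₂ (_ , e)) → eval-commutes e }
    }

  -- The signature of the closure of A names the elements of A, so B is expanded over
  -- that signature by their images.
  pointed : Algebra (closureSignature A) c′ ℓ′
  pointed = record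
    { carrier = B.carrier
    ; op      = λ { (inj₁ g) → B.op g      ; (inj₂ (_ , x)) _ → ⟦ x ⟧ }
    ; op-cong = λ { (inj₁ g) → B.op-cong g ; (inj₂ (t , _)) _ → Setoid.refl (B.carrier t) }
    }

  closure-morphism : Morphism (closure A) pointed
  closure-morphism = record
    { hom      = hom
    ; commutes = λ { (inj₁ g) → commutes g ; (inj₂ (t , _)) _ → Setoid.refl (B.carrier t) }
    }

module _ {S : Signature s f} {A : Algebra S c ℓ} (D : Subalgebra A p q)
         {B : Algebra S c′ ℓ′} (h : Morphism A B) where
  private
    module B = Algebra B
    module D = Subalgebra D
  open Morphism h

  -- Only symbols are discarded. The carriers stay whole, so local finiteness of `B` passes on
  -- unchanged.
  reduct : Algebra D.signature c′ ℓ′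
  reduct = record
    { carrier = B.carrier ; op = B.op ∘ proj₁ ; op-cong = λ g → B.op-cong (proj₁ g) }

  restriction : Morphism D.algebra reduct
  restriction = record
    { hom      = λ t → record { to = λ x → ⟦ proj₁ x ⟧ ; cong = Func.cong (hom t) }
    ; commutes = λ (g , _) xs → Setoid.trans (B.carrier _) (commutes g (All.map proj₁ xs))
                   (B.op-cong g (pointwise-reflexive B.carrier (map-∘ xs)))
    }

-- Closure, flattening and passing to a reduct leave the carriers of the recognising algebra alone,
-- so the same finiteness proof and the same accepting set serve again.
recognisable-inherited :
  {S : Signature s f} {A : Algebra S c ℓ} (D : InheritedFrom A p q) {t : Signature.Sort S}
  {L : Pred (Algebra.∣_∣ₜ A t) r} → Recognisable A t L →
  Recognisable (Subalgebra.algebra D) t (L ∘ proj₁)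
recognisable-inherited D (B , finite , h , M , M-resp , L⇔M) =
  reduct D h′ , finite , restriction D h′ , M , M-resp , L⇔M ∘ proj₁
  where h′ = Fl-morphism (closure-morphism h)

does⇒ : (a? : Dec A) → does a? ≡ true → A
does⇒ (yes a) _ = a

does⇔ : (a? : Dec A) → does a? ≡ true ⇔ A
does⇔ a? = mk⇔ (does⇒ a?) (dec-true a?)

-- Finite types

FiniteType : Set → Set
FiniteType A = Finite (setoid A)

finite-⇿ : A ↔ B → FiniteType A → FiniteType B
finite-⇿ A↔B (k , A↔k) = k , ↔-trans (↔-sym A↔B) A↔k

finite-Fin : FiniteType (Fin n)
finite-Fin = _ , ↔-refl

finite-× : FiniteType A → FiniteType B → FiniteType (A × B)
finite-× (_ , A↔k) (_ , B↔l) = _ , ↔-trans (A↔k ×-↔ B↔l) (↔-sym *↔×)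

finite-Bool : FiniteType Bool
finite-Bool = finite-⇿ 2↔Bool finite-Fin

finite-Vec : FiniteType A → ∀ n → FiniteType (Vec A n)
finite-Vec fin zero    = 1 , mk↔ₛ′ (λ _ → zero) (λ _ → []) (λ { zero → refl }) (λ { [] → refl })
finite-Vec fin (suc n) = finite-⇿
  (mk↔ₛ′ (λ (x , xs) → x ∷ xs) (λ { (x ∷ xs) → x , xs })
         (λ { (_ ∷ _) → refl }) (λ { (_ , _) → refl }))
  (finite-× fin (finite-Vec fin n))

-- Subsets are Boolean vectors along an enumeration of `A`. Equivalent decidable predicates thereby
-- yield propositionally equal subsets, as needed when sets of states are themselves states.
module Powerset (fin : FiniteType A) where
  private
    module I = Inverse (proj₂ fin)
    k = proj₁ fin

  infix 4 _≟_ _∈_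

  Powerset : Set
  Powerset = Subset k

  finite-Powerset : FiniteType Powerset
  finite-Powerset = finite-Vec finite-Bool k

  abstract
    any? : {P : A → Set} → (∀ a → Dec (P a)) → Dec (∃ P)
    any? {P} P? = map′ (λ (i , p) → I.from i , p)
                       (λ (a , p) → I.to a , subst P (sym (I.strictlyInverseʳ a)) p)
                       (Fin.any? (P? ∘ I.from))

    _≟_ : (a b : A) → Dec (a ≡ b)
    a ≟ b = map′ (λ e → trans (sym (I.strictlyInverseʳ a)) (I.inverseʳ e)) (cong I.to)
                 (I.to a Fin.≟ I.to b)

    _∈_ : A → Powerset → Set
    a ∈ S = lookup S (I.to a) ≡ true

    _∈?_ : ∀ a S → Dec (a ∈ S)
    a ∈? S = lookup S (I.to a) ≟ᴮ true

    comprehension : {P : A → Set} → (∀ a → Dec (P a)) → Powerset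
    comprehension P? = tabulate (does ∘ P? ∘ I.from)

    ∈-comprehension : {P : A → Set} (P? : ∀ a → Dec (P a)) → ∀ a → a ∈ comprehension P? ⇔ P a
    ∈-comprehension P? a rewrite lookup∘tabulate (does ∘ P? ∘ I.from) (I.to a)
                               | I.strictlyInverseʳ a = does⇔ (P? a)

    comprehension-cong : {P Q : A → Set} (P? : ∀ a → Dec (P a)) (Q? : ∀ a → Dec (Q a)) →
                         (∀ a → P a ⇔ Q a) → comprehension P? ≡ comprehension Q?
    comprehension-cong P? Q? P⇔Q = tabulate-cong λ i → does-⇔ (P⇔Q (I.from i)) (P? _) (Q? _)

-- Graph morphisms and coloured graphs

-- Isomorphisms, both inclusions into a disjoint sum and the projection onto a fusion are instances,
-- so the naturality of an atomic test is proved once for all of them. Terminals are left out, since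
-- formulas do not see them.
record Hom (G H : Graph) : Set where
  private
    module G = Graph G
    module H = Graph H
  field
    onV   : G.V → H.V
    onE   : G.E → H.E
    words : ∀ e → List⁺.map onV G.⟨ e ⟩ ≡ H.⟨ onE e ⟩

  apply : Ω.Element G → Ω.Element H
  apply = Sum.map onV onE

open Hom using (apply)
open TypedGraph using (graph)

private variable
  Γ Δ : Graph
  G H : TypedGraph n

iso : G ≅ H → Hom (graph G) (graph H)
iso φ = record { onV = Inverse.to vertices ; onE = Inverse.to edges ; words = words }
  where open _≅_ φ

left : (G : TypedGraph n) (H : TypedGraph m) → Hom (graph G) (graph (G ⊕ H))
left G H = record
  { onV = _↑ˡ suc H.order-1 ; onE = _↑ˡ H.size
  ; words = λ e → cong [ _ , _ ]′ (sym (splitAt-↑ˡ G.size e H.size)) }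
  where
  module G = TypedGraph G
  module H = TypedGraph H

right : (G : TypedGraph n) (H : TypedGraph m) → Hom (graph H) (graph (G ⊕ H))
right G H = record
  { onV = suc G.order-1 ↑ʳ_ ; onE = G.size ↑ʳ_
  ; words = λ e → cong [ _ , _ ]′ (sym (splitAt-↑ʳ G.size H.size e)) }
  where
  module G = TypedGraph G
  module H = TypedGraph H

module Fusion (a b : Fin n) (G : TypedGraph n) where
  open TypedGraph G using (terminal)
  open Identification (identify (terminal a) (terminal b)) public

quotient : (a b : Fin n) (G : TypedGraph n) → Hom (graph G) (graph (fuse a b G))
quotient a b G = record { onV = π ; onE = id ; words = λ _ → refl }
  where open Fusion a b G

data Split {k l} : Fin (k + l) → Set where
  inˡ : (i : Fin k) → Split (i ↑ˡ l)
  inʳ : (j : Fin l) → Split (k ↑ʳ j)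

split : ∀ k {l} (i : Fin (k + l)) → Split {k} i
split k i with splitAt k i in eq
... | inj₁ j rewrite sym (splitAt⁻¹-↑ˡ eq) = inˡ j
... | inj₂ j rewrite sym (splitAt⁻¹-↑ʳ eq) = inʳ j

⊕-cover : (G : TypedGraph n) (H : TypedGraph m) (z : Ω.Element (graph (G ⊕ H))) →
          (∃[ x ] apply (left G H) x ≡ z) ⊎ (∃[ y ] apply (right G H) y ≡ z)
⊕-cover G H (inj₁ v) with split (suc (TypedGraph.order-1 G)) v
... | inˡ i = inj₁ (inj₁ i , refl)
... | inʳ j = inj₂ (inj₁ j , refl)
⊕-cover G H (inj₂ e) with split (TypedGraph.size G) e
... | inˡ i = inj₁ (inj₂ i , refl)
... | inʳ j = inj₂ (inj₂ j , refl)

lift : (a b : Fin n) (G : TypedGraph n) → Ω.Element (graph (fuse a b G)) → Ω.Element (graph G)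
lift a b G = Sum.map₁ (Fusion.section a b G)

quotient-lift : (a b : Fin n) (G : TypedGraph n) → ∀ z → apply (quotient a b G) (lift a b G z) ≡ z
quotient-lift a b G (inj₁ v) = cong inj₁ (Fusion.π-section a b G v)
quotient-lift a b G (inj₂ e) = refl

-- A colour may mix vertices and edges, unlike a value of a set variable in Ω: the translation
-- of ∀-set restricts quantification to unmixed colours by homogeneousᴿ.
Colour : Graph → Set
Colour Γ = Ω.Element Γ → Bool

Colouring : Set → Graph → Set
Colouring K Γ = K → Colour Γ

infixl 9 _∘ᶜ_
infixr 5 _▹_

_∘ᶜ_ : Colouring K Δ → Hom Γ Δ → Colouring K Γ
(c ∘ᶜ f) κ = c κ ∘ apply f

_▹_ : {X : Set} → X → (K → X) → Maybe K → X
g ▹ c = maybe′ c g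

Preserves : Hom Γ Δ → Colouring K Γ → Colouring K Δ → Set
Preserves f c d = ∀ κ → c κ ≗ d κ ∘ apply f

any-element? : {P : Ω.Element Γ → Set} → (∀ z → Dec (P z)) → Dec (∃ P)
any-element? P? = map′
  [ (λ (v , p) → inj₁ v , p) , (λ (e , p) → inj₂ e , p) ]′
  (λ { (inj₁ v , p) → inj₁ (v , p) ; (inj₂ e , p) → inj₂ (e , p) })
  (Fin.any? (P? ∘ inj₁) ⊎-dec Fin.any? (P? ∘ inj₂))

-- Colours are functions and are not enumerated up to `≡`. The search runs over pairs of subsets
-- instead; `resp` carries a witness over to its tabulation.
any-colour? : ∀ {Γ} {P : Colour Γ → Set} → (∀ {f g} → f ≗ g → P f → P g) →
              (∀ f → Dec (P f)) → Dec (∃ P)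
any-colour? resp P? = map′
  (λ (X , Y , p) → [ lookup X , lookup Y ]′ , p)
  (λ (f , p) → tabulate (f ∘ inj₁) , tabulate (f ∘ inj₂) ,
    resp (λ { (inj₁ v) → sym (lookup∘tabulate (f ∘ inj₁) v)
            ; (inj₂ e) → sym (lookup∘tabulate (f ∘ inj₂) e) }) p)
  (anySubset? λ X → anySubset? λ Y → P? [ lookup X , lookup Y ]′)

-- Recognisers

-- A finite deterministic automaton on graphs with colours named by `K`: for each number of
-- terminals a finite set of states, on which the state of a composite graph is computed from the
-- states of its parts. The constants have no field of their own, as `value` already gives their
-- states.
record Recogniser (K : Set) : Set₁ where
  no-eta-equality
  field
    State       : ℕ → Set
    finite      : ∀ n → FiniteType (State n)
    accept      : State n → Bool
    value       : (G : TypedGraph n) → Colouring K (graph G) → State n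
    value-cong  : {G H : TypedGraph n} (φ : G ≅ H) {c : Colouring K (graph G)}
                  {d : Colouring K (graph H)} →
                  Preserves (iso φ) c d → value G c ≡ value H d
    ⊕ˢ          : State n → State m → State (n + m)
    value-⊕     : (G : TypedGraph n) (H : TypedGraph m) (c : Colouring K (graph (G ⊕ H))) →
                  value (G ⊕ H) c ≡ ⊕ˢ (value G (c ∘ᶜ left G H)) (value H (c ∘ᶜ right G H))
    redefineˢ   : (Fin n → Fin m) → State m → State n
    value-redefine : (σ : Fin n → Fin m) (G : TypedGraph m) (c : Colouring K (graph G)) →
                  value (redefine σ G) c ≡ redefineˢ σ (value G c)
    fuseˢ       : Fin n → Fin n → State n → State n
    value-fuse  : (a b : Fin n) (G : TypedGraph n) (c : Colouring K (graph (fuse a b G))) →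
                  value (fuse a b G) c ≡ fuseˢ a b (value G (c ∘ᶜ quotient a b G))

  Accepts : (G : TypedGraph n) → Colouring K (graph G) → Set
  Accepts G c = accept (value G c) ≡ true

  value-≗ : (G : TypedGraph n) {c d : Colouring K (graph G)} →
            (∀ κ → c κ ≗ d κ) → value G c ≡ value G d
  value-≗ G c≗d = value-cong ≅-refl
    -- The map on elements induced by `≅-refl` reduces to the identity only on constructors.
    λ { κ (inj₁ v) → c≗d κ (inj₁ v) ; κ (inj₂ e) → c≗d κ (inj₂ e) }

  Accepts-≗ : (G : TypedGraph n) {c d : Colouring K (graph G)} →
              (∀ κ → c κ ≗ d κ) → Accepts G c → Accepts G d
  Accepts-≗ G c≗d = trans (cong accept (sym (value-≗ G c≗d)))

open Recogniser using (Accepts; Accepts-≗)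

-- Renaming of colours and Boolean operations

rename : (K → K′) → Recogniser K → Recogniser K′
rename r R = record
  { State = State ; finite = finite ; accept = accept
  ; value = λ G c → value G (c ∘ r)
  ; value-cong = λ φ pres → value-cong φ (pres ∘ r)
  ; ⊕ˢ = ⊕ˢ ; value-⊕ = λ G H c → value-⊕ G H (c ∘ r)
  ; redefineˢ = redefineˢ ; value-redefine = λ σ G c → value-redefine σ G (c ∘ r)
  ; fuseˢ = fuseˢ ; value-fuse = λ a b G c → value-fuse a b G (c ∘ r)
  }
  where open Recogniser R hiding (Accepts; Accepts-≗)

module _ (R : Recogniser K) where
  open Recogniser R hiding (Accepts; Accepts-≗)

  accepts? : (G : TypedGraph n) (c : Colouring K (graph G)) → Dec (Accepts R G c)
  accepts? G c = accept (value G c) ≟ᴮ true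

  abstract

    notᴿ : Recogniser K
    notᴿ = record
      { State = State ; finite = finite ; accept = not ∘ accept
      ; value = value ; value-cong = value-cong
      ; ⊕ˢ = ⊕ˢ ; value-⊕ = value-⊕
      ; redefineˢ = redefineˢ ; value-redefine = value-redefine
      ; fuseˢ = fuseˢ ; value-fuse = value-fuse
      }

    accepts-not : (G : TypedGraph n) (c : Colouring K (graph G)) →
                  Accepts notᴿ G c ⇔ (¬ Accepts R G c)
    accepts-not G c with accept (value G c)
    ... | true  = mk⇔ (λ ()) (λ ¬p → contradiction refl ¬p)
    ... | false = mk⇔ (λ _ ()) (λ _ → refl)

module _ (R S : Recogniser K) where
  private
    module R = Recogniser R
    module S = Recogniser S

  abstract

    andᴿ : Recogniser K
    andᴿ = record
      { State          = λ n → R.State n × S.State n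
      ; finite         = λ n → finite-× (R.finite n) (S.finite n)
      ; accept         = λ (x , y) → R.accept x ∧ S.accept y
      ; value          = λ G c → R.value G c , S.value G c
      ; value-cong     = λ φ pres → cong₂ _,_ (R.value-cong φ pres) (S.value-cong φ pres)
      ; ⊕ˢ             = λ (x , y) (x′ , y′) → R.⊕ˢ x x′ , S.⊕ˢ y y′
      ; value-⊕        = λ G H c → cong₂ _,_ (R.value-⊕ G H c) (S.value-⊕ G H c)
      ; redefineˢ      = λ σ (x , y) → R.redefineˢ σ x , S.redefineˢ σ y
      ; value-redefine = λ σ G c → cong₂ _,_ (R.value-redefine σ G c) (S.value-redefine σ G c)
      ; fuseˢ          = λ a b (x , y) → R.fuseˢ a b x , S.fuseˢ a b y
      ; value-fuse     = λ a b G c → cong₂ _,_ (R.value-fuse a b G c) (S.value-fuse a b G c)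
      }

    accepts-and : (G : TypedGraph n) (c : Colouring K (graph G)) →
                  Accepts andᴿ G c ⇔ (Accepts R G c × Accepts S G c)
    accepts-and G c with R.accept (R.value G c)
    ... | true  = mk⇔ (refl ,_) proj₂
    ... | false = mk⇔ (λ ()) (λ ())

impliesᴿ : Recogniser K → Recogniser K → Recogniser K
impliesᴿ R S = notᴿ (andᴿ R (notᴿ S))

-- Acceptance is a Boolean equation, hence decidable and stable under double negation, so the
-- classical encoding by negation and conjunction is constructively an implication.
accepts-implies : (R S : Recogniser K) (G : TypedGraph n) (c : Colouring K (graph G)) →
                  Accepts (impliesᴿ R S) G c ⇔ (Accepts R G c → Accepts S G c)
accepts-implies R S G c = mk⇔
  (λ acc r → decidable-stable (accepts? S G c) λ ¬s →
     to not⇔ acc (from and⇔ (r , from (accepts-not S G c) ¬s)))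
  (λ r⇒s → from not⇔ λ both → let r , ¬s = to and⇔ both in to (accepts-not S G c) ¬s (r⇒s r))
  where
  not⇔ = accepts-not (andᴿ R (notᴿ S)) G c
  and⇔ = accepts-and R (notᴿ S) G c

-- Colours chosen independently on the two summands come from a common colour of the sum. This makes
-- every pair of reached outcomes jointly reachable.
glue : (G : TypedGraph n) (H : TypedGraph m) → Colour (graph G) → Colour (graph H) →
       Colour (graph (G ⊕ H))
glue G H f g (inj₁ v) = [ f ∘ inj₁ , g ∘ inj₁ ]′ (splitAt (suc (TypedGraph.order-1 G)) v)
glue G H f g (inj₂ e) = [ f ∘ inj₂ , g ∘ inj₂ ]′ (splitAt (TypedGraph.size G) e)

glue-left : (G : TypedGraph n) (H : TypedGraph m) (f : Colour (graph G)) (g : Colour (graph H)) →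
            glue G H f g ∘ apply (left G H) ≗ f
glue-left G H f g (inj₁ v) = cong [ _ , _ ]′ (splitAt-↑ˡ (suc G.order-1) v (suc H.order-1))
  where module G = TypedGraph G ; module H = TypedGraph H
glue-left G H f g (inj₂ e) = cong [ _ , _ ]′ (splitAt-↑ˡ (TypedGraph.size G) e (TypedGraph.size H))

glue-right : (G : TypedGraph n) (H : TypedGraph m) (f : Colour (graph G)) (g : Colour (graph H)) →
             glue G H f g ∘ apply (right G H) ≗ g
glue-right G H f g (inj₁ v) = cong [ _ , _ ]′ (splitAt-↑ʳ (suc G.order-1) (suc H.order-1) v)
  where module G = TypedGraph G ; module H = TypedGraph H
glue-right G H f g (inj₂ e) = cong [ _ , _ ]′ (splitAt-↑ʳ (TypedGraph.size G) (TypedGraph.size H) e)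

-- Quantification

terminalColours : (G : TypedGraph n) → Colour (graph G) → Vec Bool n
terminalColours G f = tabulate (f ∘ inj₁ ∘ TypedGraph.terminal G)

_⊕ᵗ_ : {A : Set} → Vec A n → Vec A m → Vec A (n + m)
_⊕ᵗ_ {n} u w = tabulate ([ lookup u , lookup w ]′ ∘ splitAt n)

terminalColours-⊕ : (G : TypedGraph n) (H : TypedGraph m) (f : Colour (graph (G ⊕ H))) →
  terminalColours (G ⊕ H) f ≡
  terminalColours G (f ∘ apply (left G H)) ⊕ᵗ terminalColours H (f ∘ apply (right G H))
terminalColours-⊕ {n} G H f = tabulate-cong λ i → go (splitAt n i)
  where
  go : ∀ s → f (inj₁ ([ Hom.onV (left G H) ∘ TypedGraph.terminal G
                      , Hom.onV (right G H) ∘ TypedGraph.terminal H ]′ s))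
           ≡ [ lookup (terminalColours G (f ∘ apply (left G H)))
             , lookup (terminalColours H (f ∘ apply (right G H))) ]′ s
  go (inj₁ i) = sym (lookup∘tabulate _ i)
  go (inj₂ j) = sym (lookup∘tabulate _ j)

-- A colour of the fusion of a and b is a colour of the original graph which agrees on these
-- terminals; hence the states of a projection record the colours of the terminals.
module _ (R : Recogniser (Maybe K)) where
  open Recogniser R hiding (Accepts; Accepts-≗)

  private
    Outcome : ℕ → Set
    Outcome n = State n × Vec Bool n

    outcome : (G : TypedGraph n) → Colouring K (graph G) → Colour (graph G) → Outcome n
    outcome G c f = value G (f ▹ c) , terminalColours G f

    module P n = Powerset (finite-× (finite n) (finite-Vec finite-Bool n))
    open module P′ {n} = P n
      using (comprehension; comprehension-cong; ∈-comprehension; _∈_; _∈?_; any?; _≟_)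

    outcome-cong : {G H : TypedGraph n} (φ : G ≅ H) {c : Colouring K (graph G)}
                   {d : Colouring K (graph H)} {f : Colour (graph G)} {g : Colour (graph H)} →
                   Preserves (iso φ) c d → f ≗ g ∘ apply (iso φ) →
                   outcome G c f ≡ outcome H d g
    outcome-cong φ {g = g} c≈d f≗g =
      cong₂ _,_ (value-cong φ λ { nothing → f≗g ; (just κ) → c≈d κ })
                (tabulate-cong λ i → trans (f≗g _) (cong (g ∘ inj₁) (_≅_.terminals φ i)))

    outcome-≗ : (G : TypedGraph n) (c : Colouring K (graph G)) {f g : Colour (graph G)} →
                f ≗ g → outcome G c f ≡ outcome G c g
    outcome-≗ G c f≗g = cong₂ _,_ (value-≗ G λ { nothing → f≗g ; (just κ) _ → refl })
                                  (tabulate-cong λ i → f≗g _)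

    Reached : (G : TypedGraph n) → Colouring K (graph G) → Outcome n → Set
    Reached G c z = ∃[ f ] outcome G c f ≡ z

    reached? : (G : TypedGraph n) (c : Colouring K (graph G)) → ∀ z → Dec (Reached G c z)
    reached? G c z = any-colour? {graph G} (λ f≗g → trans (sym (outcome-≗ G c f≗g)))
                                 (λ f → outcome G c f ≟ z)

    -- The subset construction: the bound colour is guessed, and the state collects the outcomes of
    -- all guesses.
    reach : (G : TypedGraph n) → Colouring K (graph G) → P.Powerset n
    reach G c = comprehension (reached? G c)

    ∈-reach : (G : TypedGraph n) (c : Colouring K (graph G)) → ∀ z → z ∈ reach G c ⇔ Reached G c z
    ∈-reach G c = ∈-comprehension (reached? G c)

    reach-cong : {G H : TypedGraph n} (φ : G ≅ H) {c : Colouring K (graph G)}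
                 {d : Colouring K (graph H)} → Preserves (iso φ) c d → reach G c ≡ reach H d
    reach-cong {G = G} {H} φ {c} {d} c≈d =
      comprehension-cong (reached? G c) (reached? H d) λ z → mk⇔
        (λ (f , eq) → f ∘ apply (iso (≅-sym φ)) ,
           trans (sym (outcome-cong φ c≈d λ x → sym (cong f (back x)))) eq)
        (λ (g , eq) → g ∘ apply (iso φ) , trans (outcome-cong φ c≈d λ _ → refl) eq)
      where
      back : ∀ x → apply (iso (≅-sym φ)) (apply (iso φ) x) ≡ x
      back (inj₁ v) = cong inj₁ (Inverse.strictlyInverseʳ (_≅_.vertices φ) v)
      back (inj₂ e) = cong inj₂ (Inverse.strictlyInverseʳ (_≅_.edges φ) e)

    _⊕ᵒ_ : Outcome n → Outcome m → Outcome (n + m)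
    (x , u) ⊕ᵒ (y , w) = ⊕ˢ x y , u ⊕ᵗ w

    outcome-⊕ : (G : TypedGraph n) (H : TypedGraph m) (c : Colouring K (graph (G ⊕ H)))
                (f : Colour (graph (G ⊕ H))) →
                outcome (G ⊕ H) c f ≡ outcome G (c ∘ᶜ left G H) (f ∘ apply (left G H)) ⊕ᵒ
                                      outcome H (c ∘ᶜ right G H) (f ∘ apply (right G H))
    outcome-⊕ G H c f = cong₂ _,_
      (trans (value-⊕ G H (f ▹ c)) (cong₂ ⊕ˢ
        -- Extending by the bound colour commutes with restriction only after a case split on the
        -- colour name.
        (value-≗ G λ { nothing _ → refl ; (just κ) _ → refl })
        (value-≗ H λ { nothing _ → refl ; (just κ) _ → refl })))
      (terminalColours-⊕ G H f)

    Sum : P.Powerset n → P.Powerset m → Outcome (n + m) → Set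
    Sum S T z = ∃[ x ] ∃[ y ] x ∈ S × y ∈ T × x ⊕ᵒ y ≡ z

    sum? : (S : P.Powerset n) (T : P.Powerset m) → ∀ z → Dec (Sum S T z)
    sum? S T z = any? λ x → any? λ y → x ∈? S ×-dec y ∈? T ×-dec x ⊕ᵒ y ≟ z

    ⊕ᵖ : P.Powerset n → P.Powerset m → P.Powerset (n + m)
    ⊕ᵖ S T = comprehension (sum? S T)

    -- From left to right a colour of the sum is restricted to the summands; from right to left two
    -- witnesses are glued.
    reach-⊕ : (G : TypedGraph n) (H : TypedGraph m) (c : Colouring K (graph (G ⊕ H))) →
              reach (G ⊕ H) c ≡ ⊕ᵖ (reach G (c ∘ᶜ left G H)) (reach H (c ∘ᶜ right G H))
    reach-⊕ G H c = comprehension-cong (reached? (G ⊕ H) c) (sum? _ _) λ z → mk⇔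
      (λ (f , eq) → _ , _ , from (∈-reach G _ _) (_ , refl) , from (∈-reach H _ _) (_ , refl) ,
         trans (sym (outcome-⊕ G H c f)) eq)
      (λ (x , y , x∈ , y∈ , eq) →
         let f , fx = to (∈-reach G _ x) x∈
             g , gy = to (∈-reach H _ y) y∈
         in glue G H f g ,
            trans (outcome-⊕ G H c (glue G H f g))
              (trans (cong₂ _⊕ᵒ_ (trans (outcome-≗ G _ (glue-left G H f g)) fx)
                                 (trans (outcome-≗ H _ (glue-right G H f g)) gy)) eq))

    redefineᵒ : (Fin n → Fin m) → Outcome m → Outcome n
    redefineᵒ σ (x , u) = redefineˢ σ x , tabulate (lookup u ∘ σ)

    outcome-redefine : (σ : Fin n → Fin m) (G : TypedGraph m) (c : Colouring K (graph G))
                       (f : Colour (graph G)) →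
                       outcome (redefine σ G) c f ≡ redefineᵒ σ (outcome G c f)
    outcome-redefine σ G c f = cong₂ _,_ (value-redefine σ G (f ▹ c))
      (tabulate-cong λ i → sym (lookup∘tabulate _ (σ i)))

    Redefine : (Fin n → Fin m) → P.Powerset m → Outcome n → Set
    Redefine σ S z = ∃[ x ] x ∈ S × redefineᵒ σ x ≡ z

    redefine? : (σ : Fin n → Fin m) (S : P.Powerset m) → ∀ z → Dec (Redefine σ S z)
    redefine? σ S z = any? λ x → x ∈? S ×-dec redefineᵒ σ x ≟ z

    redefineᵖ : (Fin n → Fin m) → P.Powerset m → P.Powerset n
    redefineᵖ σ S = comprehension (redefine? σ S)

    reach-redefine : (σ : Fin n → Fin m) (G : TypedGraph m) (c : Colouring K (graph G)) →
                     reach (redefine σ G) c ≡ redefineᵖ σ (reach G c)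
    reach-redefine σ G c = comprehension-cong (reached? (redefine σ G) c) (redefine? σ _) λ z → mk⇔
      (λ (f , eq) → _ , from (∈-reach G c _) (f , refl) ,
                    trans (sym (outcome-redefine σ G c f)) eq)
      (λ (x , x∈ , eq) → let f , fx = to (∈-reach G c x) x∈ in
         f , trans (outcome-redefine σ G c f) (trans (cong (redefineᵒ σ) fx) eq))

    fuseᵒ : Fin n → Fin n → Outcome n → Outcome n
    fuseᵒ a b (x , u) = fuseˢ a b x , u

    outcome-fuse : (a b : Fin n) (G : TypedGraph n) (c : Colouring K (graph (fuse a b G)))
                   (f : Colour (graph (fuse a b G))) →
                   outcome (fuse a b G) c f ≡
                   fuseᵒ a b (outcome G (c ∘ᶜ quotient a b G) (f ∘ apply (quotient a b G)))
    -- The terminal colours agree by computation: the terminals of the fusion are the projected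
    -- terminals of `G`.
    outcome-fuse a b G c f = cong (_, _) (trans (value-fuse a b G (f ▹ c))
      (cong (fuseˢ a b) (value-≗ G λ { nothing _ → refl ; (just κ) _ → refl })))

    Agree : Fin n → Fin n → Outcome n → Set
    Agree a b (_ , u) = lookup u a ≡ lookup u b

    -- The chosen representative of the class of `v` is either `v` itself or the other one of the
    -- two fused terminals, where `f` has the same value by agreement.
    descend : (a b : Fin n) (G : TypedGraph n) (c : Colouring K (graph G)) (f : Colour (graph G)) →
              Agree a b (outcome G c f) → f ∘ lift a b G ∘ apply (quotient a b G) ≗ f
    descend a b G c f agree (inj₂ e) = refl
    descend a b G c f agree (inj₁ v) with separates (section (π v)) v (π-section (π v))
      where open Fusion a b G
    ... | inj₁ eq = cong (f ∘ inj₁) eq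
    ... | inj₂ (inj₁ (eq₁ , eq₂)) =
      trans (cong (f ∘ inj₁) eq₁) (trans ab (cong (f ∘ inj₁) (sym eq₂)))
      where ab = trans (sym (lookup∘tabulate _ a)) (trans agree (lookup∘tabulate _ b))
    ... | inj₂ (inj₂ (eq₁ , eq₂)) =
      trans (cong (f ∘ inj₁) eq₁) (trans (sym ab) (cong (f ∘ inj₁) (sym eq₂)))
      where ab = trans (sym (lookup∘tabulate _ a)) (trans agree (lookup∘tabulate _ b))

    ascend : (a b : Fin n) (G : TypedGraph n) (c : Colouring K (graph (fuse a b G)))
             (f : Colour (graph (fuse a b G))) →
             Agree a b (outcome G (c ∘ᶜ quotient a b G) (f ∘ apply (quotient a b G)))
    ascend a b G c f = trans (lookup∘tabulate _ a)
      (trans (cong (f ∘ inj₁) (Fusion.identifies a b G)) (sym (lookup∘tabulate _ b)))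

    Fuse : Fin n → Fin n → P.Powerset n → Outcome n → Set
    Fuse a b S z = ∃[ x ] x ∈ S × Agree a b x × fuseᵒ a b x ≡ z

    fuse? : (a b : Fin n) (S : P.Powerset n) → ∀ z → Dec (Fuse a b S z)
    fuse? a b S z = any? λ x →
      x ∈? S ×-dec lookup (proj₂ x) a ≟ᴮ lookup (proj₂ x) b ×-dec fuseᵒ a b x ≟ z

    fuseᵖ : Fin n → Fin n → P.Powerset n → P.Powerset n
    fuseᵖ a b S = comprehension (fuse? a b S)

    reach-fuse : (a b : Fin n) (G : TypedGraph n) (c : Colouring K (graph (fuse a b G))) →
                 reach (fuse a b G) c ≡ fuseᵖ a b (reach G (c ∘ᶜ quotient a b G))
    reach-fuse a b G c = comprehension-cong (reached? (fuse a b G) c) (fuse? a b _) λ z → mk⇔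
      (λ (f , eq) → _ , from (∈-reach G _ _) (_ , refl) , ascend a b G c f ,
                    trans (sym (outcome-fuse a b G c f)) eq)
      (λ { (x , x∈ , agree , eq) → fromState x agree eq (to (∈-reach G _ x) x∈) })
      where
      d = c ∘ᶜ quotient a b G
      fromState : ∀ {z} x → Agree a b x → fuseᵒ a b x ≡ z → Reached G d x →
                  Reached (fuse a b G) c z
      -- The colour of the fusion is read at representatives; agreement ensures that its pullback is
      -- `f` again.
      fromState _ agree eq (f , refl) = f ∘ lift a b G ,
        trans (outcome-fuse a b G c _)
          (trans (cong (fuseᵒ a b) (outcome-≗ G d (descend a b G d f agree))) eq)

    accepting? : (S : P.Powerset n) → Dec (∃[ z ] z ∈ S × accept (proj₁ z) ≡ true)
    accepting? S = any? λ z → z ∈? S ×-dec accept (proj₁ z) ≟ᴮ true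

  abstract

    existsᴿ : Recogniser K
    existsᴿ = record
      { State = P.Powerset ; finite = P.finite-Powerset ; accept = does ∘ accepting?
      ; value = reach ; value-cong = reach-cong
      ; ⊕ˢ = ⊕ᵖ ; value-⊕ = reach-⊕
      ; redefineˢ = redefineᵖ ; value-redefine = reach-redefine
      ; fuseˢ = fuseᵖ ; value-fuse = reach-fuse
      }

    accepts-exists : (G : TypedGraph n) (c : Colouring K (graph G)) →
                     Accepts existsᴿ G c ⇔ (∃[ f ] Accepts R G (f ▹ c))
    accepts-exists G c = mk⇔
      (λ acc → let z , z∈ , ok = does⇒ (accepting? (reach G c)) acc
                   f , fz = to (∈-reach G c z) z∈
               in f , trans (cong (accept ∘ proj₁) fz) ok)
      (λ (f , ok) → dec-true (accepting? (reach G c)) (_ , from (∈-reach G c _) (f , refl) , ok))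

allᴿ : Recogniser (Maybe K) → Recogniser K
allᴿ R = notᴿ (existsᴿ (notᴿ R))

accepts-all : (R : Recogniser (Maybe K)) (G : TypedGraph n) (c : Colouring K (graph G)) →
              Accepts (allᴿ R) G c ⇔ (∀ f → Accepts R G (f ▹ c))
accepts-all R G c = mk⇔
  (λ acc f → decidable-stable (accepts? R G (f ▹ c)) λ ¬ok →
     to (accepts-not (existsᴿ (notᴿ R)) G c) acc
       (from (accepts-exists (notᴿ R) G c) (f , from (accepts-not R G (f ▹ c)) ¬ok)))
  (λ all → from (accepts-not (existsᴿ (notᴿ R)) G c) λ acc →
     let f , ok = to (accepts-exists (notᴿ R) G c) acc
     in to (accepts-not R G (f ▹ c)) ok (all f))

-- Atomic formulas

-- `natural` is an equality of Booleans, so the outcome at an element is both preserved and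
-- reflected by every morphism, including the projections of fusions, which need not be injective.
record LocalTest (K : Set) : Set where
  no-eta-equality
  field
    test    : (Γ : Graph) → Colouring K Γ → Ω.Element Γ → Bool
    natural : (f : Hom Γ Δ) {c : Colouring K Γ} {d : Colouring K Δ} → Preserves f c d →
              test Γ c ≗ test Δ d ∘ apply f

iso-cover : {G H : TypedGraph n} (φ : G ≅ H) → ∀ y → ∃[ x ] apply (iso φ) x ≡ y
iso-cover φ (inj₁ v) = inj₁ (V.from v) , cong inj₁ (V.strictlyInverseˡ v)
  where module V = Inverse (_≅_.vertices φ)
iso-cover φ (inj₂ e) = inj₂ (E.from e) , cong inj₂ (E.strictlyInverseˡ e)
  where module E = Inverse (_≅_.edges φ)

module _ (L : LocalTest K) where
  open LocalTest L

  Passes : (Γ : Graph) → Colouring K Γ → Set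
  Passes Γ c = ∃[ z ] test Γ c z ≡ true

  passes? : (Γ : Graph) (c : Colouring K Γ) → Dec (Passes Γ c)
  passes? Γ c = any-element? {Γ} λ z → test Γ c z ≟ᴮ true

  passes-image : (f : Hom Γ Δ) {c : Colouring K Γ} {d : Colouring K Δ} →
                 Preserves f c d → Passes Γ c → Passes Δ d
  passes-image f c≈d (x , px) = apply f x , trans (sym (natural f c≈d x)) px

  passes-surjective : (f : Hom Γ Δ) → (∀ y → ∃[ x ] apply f x ≡ y) →
                      {c : Colouring K Γ} {d : Colouring K Δ} → Preserves f c d →
                      Passes Γ c ⇔ Passes Δ d
  passes-surjective f cover c≈d = mk⇔ (passes-image f c≈d) λ (y , py) →
    let x , fx≡y = cover y
    in x , trans (natural f c≈d x) (subst (λ y → test _ _ y ≡ true) (sym fx≡y) py)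

  passes-⊕ : (G : TypedGraph n) (H : TypedGraph m) (c : Colouring K (graph (G ⊕ H))) →
             Passes (graph (G ⊕ H)) c ⇔
             (Passes (graph G) (c ∘ᶜ left G H) ⊎ Passes (graph H) (c ∘ᶜ right G H))
  passes-⊕ G H c = mk⇔ split-passes
    [ passes-image (left G H) (λ _ _ → refl) , passes-image (right G H) (λ _ _ → refl) ]′
    where
    split-passes : Passes (graph (G ⊕ H)) c →
                   Passes (graph G) (c ∘ᶜ left G H) ⊎ Passes (graph H) (c ∘ᶜ right G H)
    split-passes (z , pz) with ⊕-cover G H z
    ... | inj₁ (x , refl) = inj₁ (x , trans (natural (left G H) (λ _ _ → refl) x) pz)
    ... | inj₂ (y , refl) = inj₂ (y , trans (natural (right G H) (λ _ _ → refl) y) pz)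

  abstract

    -- One bit suffices as a state. The two inclusions cover a disjoint sum, which gives a
    -- disjunction, and isomorphisms and fusion projections are surjective on elements, so they
    -- leave the bit unchanged.
    someᴿ : Recogniser K
    someᴿ = record
      { State          = λ _ → Bool
      ; finite         = λ _ → finite-Bool
      ; accept         = id
      ; value          = λ G c → does (passes? (graph G) c)
      ; value-cong     = λ φ c≈d →
          does-⇔ (passes-surjective (iso φ) (iso-cover φ) c≈d) (passes? _ _) (passes? _ _)
      ; ⊕ˢ             = _∨_
      ; value-⊕        = λ G H c →
          does-⇔ (passes-⊕ G H c) (passes? _ c) (passes? _ _ ⊎-dec passes? _ _)
      ; redefineˢ      = λ _ → id
      ; value-redefine = λ _ _ _ → refl
      ; fuseˢ          = λ _ _ → id
      ; value-fuse     = λ a b G c → sym (does-⇔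
          (passes-surjective (quotient a b G) (λ y → lift a b G y , quotient-lift a b G y)
            (λ _ _ → refl))
          (passes? _ _) (passes? _ c))
      }

    accepts-some : (G : TypedGraph n) (c : Colouring K (graph G)) →
                   Accepts someᴿ G c ⇔ Passes (graph G) c
    accepts-some G c = does⇔ (passes? (graph G) c)

-- Cardinality modulo p

sum-++ : ∀ k {l} (f : Fin (k + l) → ℕ) → sum f ≡ sum (f ∘ (_↑ˡ l)) + sum (f ∘ (k ↑ʳ_))
sum-++ zero    f = refl
sum-++ (suc k) f = trans (cong (f zero +_) (sum-++ k (f ∘ suc))) (sym (ℕ.+-assoc (f zero) _ _))

module _ {k} {i j : Fin (suc k)} (I : Identification i j) where
  open Identification I

  -- Every case of `separates` collapses to equality, so `section` is a two-sided inverse of `π` and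
  -- the sum is merely permuted.
  sum-identify-≡ : i ≡ j → (f : Fin (suc k′) → ℕ) → sum (f ∘ π) ≡ sum f
  sum-identify-≡ refl f = sym (sum-permute f (mk↔ₛ′ π section π-section section-π))
    where
    section-π : ∀ x → section (π x) ≡ x
    section-π x with separates (section (π x)) x (π-section (π x))
    ... | inj₁ eq                  = eq
    ... | inj₂ (inj₁ (eq₁ , eq₂)) = trans eq₁ (sym eq₂)
    ... | inj₂ (inj₂ (eq₁ , eq₂)) = trans eq₁ (sym eq₂)

-- Leaving out j makes the projection bijective.
sum-identify-≢ : ∀ {k} {i j : Fin (suc k)} (I : Identification i j) → let open Identification I in
                 i ≢ j → (f : Fin (suc k′) → ℕ) → sum (f ∘ π) ≡ f (π i) + sum f
sum-identify-≢ {zero}  {zero} {zero} I i≢j f = contradiction refl i≢j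
sum-identify-≢ {suc k} {i} {j}       I i≢j f = trans (sum-remove {i = j} (f ∘ π))
  (cong₂ _+_ (cong f (sym identifies))
    (sym (sum-permute f (mk↔ₛ′ ρ (proj₁ ∘ cover) (proj₂ ∘ cover)
                               (λ x → ρ-injective _ x (proj₂ (cover (ρ x))))))))
  where
  open Identification I
  ρ = π ∘ punchIn j

  cover : ∀ y → ∃[ x ] ρ x ≡ y
  cover y with j Fin.≟ section y
  -- The representative of `y` is the vertex left out, so `i`, which lies in the same class, takes
  -- its place.
  ... | yes j≡s = punchOut (i≢j ∘ sym) , (begin
    π (punchIn j (punchOut (i≢j ∘ sym)))  ≡⟨ cong π (Fin.punchIn-punchOut _) ⟩
    π i                                   ≡⟨ identifies ⟩
    π j                                   ≡⟨ cong π j≡s ⟩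
    π (section y)                         ≡⟨ π-section y ⟩
    y                                     ∎)
    where open ≡-Reasoning
  ... | no j≢s = punchOut j≢s , trans (cong π (Fin.punchIn-punchOut j≢s)) (π-section y)

  ρ-injective : ∀ x y → ρ x ≡ ρ y → x ≡ y
  ρ-injective x y eq with separates (punchIn j x) (punchIn j y) eq
  ... | inj₁ eq′              = Fin.punchIn-injective j x y eq′
  ... | inj₂ (inj₁ (_ , eq′)) = contradiction eq′ (Fin.punchInᵢ≢i j y)
  ... | inj₂ (inj₂ (eq′ , _)) = contradiction eq′ (Fin.punchInᵢ≢i j x)

weight : Bool → ℕ
weight b = if b then 1 else 0

cardinality : (Γ : Graph) → Colour Γ → ℕ
cardinality Γ f = sum (weight ∘ f ∘ inj₁) + sum (weight ∘ f ∘ inj₂)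

cardinality-iso : {G H : TypedGraph n} (φ : G ≅ H) {f : Colour (graph G)} {g : Colour (graph H)} →
                  f ≗ g ∘ apply (iso φ) → cardinality (graph G) f ≡ cardinality (graph H) g
cardinality-iso φ {g = g} f≗g = cong₂ _+_
  (trans (sum-cong-≗ (cong weight ∘ f≗g ∘ inj₁)) (sym (sum-permute (weight ∘ g ∘ inj₁) vertices)))
  (trans (sum-cong-≗ (cong weight ∘ f≗g ∘ inj₂)) (sym (sum-permute (weight ∘ g ∘ inj₂) edges)))
  where open _≅_ φ

cardinality-⊕ : (G : TypedGraph n) (H : TypedGraph m) (f : Colour (graph (G ⊕ H))) →
                cardinality (graph (G ⊕ H)) f ≡
                cardinality (graph G) (f ∘ apply (left G H)) +
                cardinality (graph H) (f ∘ apply (right G H))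
cardinality-⊕ G H f = trans
  (cong₂ _+_ (sum-++ (suc (TypedGraph.order-1 G)) (weight ∘ f ∘ inj₁))
             (sum-++ (TypedGraph.size G) (weight ∘ f ∘ inj₂)))
  (+-interchange (sum (weight ∘ f ∘ apply (left G H) ∘ inj₁)) _ _ _)

module _ (a b : Fin n) (G : TypedGraph n) (f : Colour (graph (fuse a b G))) where
  open TypedGraph G using (terminal)
  private
    g = f ∘ apply (quotient a b G)

  cardinality-fuse-≡ : terminal a ≡ terminal b →
                       cardinality (graph G) g ≡ cardinality (graph (fuse a b G)) f
  cardinality-fuse-≡ ta≡tb =
    cong (_+ sum (weight ∘ f ∘ inj₂))
      (sum-identify-≡ (identify (terminal a) (terminal b)) ta≡tb (weight ∘ f ∘ inj₁))

  -- The original graph counts the fused class twice. Stating the equation from its side avoids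
  -- subtraction.
  cardinality-fuse-≢ : terminal a ≢ terminal b → cardinality (graph G) g ≡
                       weight (g (inj₁ (terminal a))) + cardinality (graph (fuse a b G)) f
  cardinality-fuse-≢ ta≢tb = trans
    (cong (_+ sum (weight ∘ f ∘ inj₂))
      (sum-identify-≢ (identify (terminal a) (terminal b)) ta≢tb (weight ∘ f ∘ inj₁)))
    (ℕ.+-assoc (weight (g (inj₁ (terminal a)))) _ _)

-- Coincidence of terminals

Matrix : ℕ → Set
Matrix n = Vec (Vec Bool n) n

matrix : (Fin n → Fin n → Bool) → Matrix n
matrix f = tabulate (tabulate ∘ f)

entry : Matrix n → Fin n → Fin n → Bool
entry M i j = lookup (lookup M i) j

entry-matrix : (f : Fin n → Fin n → Bool) → ∀ i j → entry (matrix f) i j ≡ f i j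
entry-matrix f i j = trans (cong (λ v → lookup v j) (lookup∘tabulate _ i)) (lookup∘tabulate _ j)

matrix-cong : {f g : Fin n → Fin n → Bool} → (∀ i j → f i j ≡ g i j) → matrix f ≡ matrix g
matrix-cong f≗g = tabulate-cong λ i → tabulate-cong (f≗g i)

module _ {n} (G : TypedGraph n) where
  open TypedGraph G

  coincide : Fin n → Fin n → Bool
  coincide i j = does (terminal i Fin.≟ terminal j)

  coincidence : Matrix n
  coincidence = matrix coincide

coincide-iso : {G H : TypedGraph n} → G ≅ H → ∀ i j → coincide G i j ≡ coincide H i j
coincide-iso φ i j = does-⇔
  (mk⇔ (λ eq → trans (sym (terminals i)) (trans (cong (Inverse.to vertices) eq) (terminals j)))
       (λ eq → Injection.injective (↔⇒↣ vertices)
                 (trans (terminals i) (trans eq (sym (terminals j))))))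
  (_ Fin.≟ _) (_ Fin.≟ _)
  where open _≅_ φ

⊕ᵐ-entry : Matrix n → Matrix m → Fin n ⊎ Fin m → Fin n ⊎ Fin m → Bool
⊕ᵐ-entry M N (inj₁ i) (inj₁ j) = entry M i j
⊕ᵐ-entry M N (inj₂ i) (inj₂ j) = entry N i j
⊕ᵐ-entry M N _        _        = false

_⊕ᵐ_ : Matrix n → Matrix m → Matrix (n + m)
_⊕ᵐ_ {n} M N = matrix λ i j → ⊕ᵐ-entry M N (splitAt n i) (splitAt n j)

left≢right : ∀ {k l} (i : Fin k) (j : Fin l) → i ↑ˡ l ≢ k ↑ʳ j
left≢right {k} {l} i j eq
  with () ← trans (sym (splitAt-↑ˡ k i l)) (trans (cong (splitAt k) eq) (splitAt-↑ʳ k l j))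

coincidence-⊕ : (G : TypedGraph n) (H : TypedGraph m) →
                coincidence (G ⊕ H) ≡ coincidence G ⊕ᵐ coincidence H
coincidence-⊕ {n} {m} G H = matrix-cong λ i j → go (splitAt n i) (splitAt n j)
  where
  module G = TypedGraph G
  module H = TypedGraph H
  t : Fin n ⊎ Fin m → TypedGraph.V (G ⊕ H)
  t = [ (λ i → G.terminal i ↑ˡ _) , (λ i → suc G.order-1 ↑ʳ H.terminal i) ]′
  go : ∀ x y → does (t x Fin.≟ t y) ≡ ⊕ᵐ-entry (coincidence G) (coincidence H) x y
  go (inj₁ i) (inj₁ j) = trans
    (does-⇔ (mk⇔ (↑ˡ-injective (suc H.order-1) _ _) (cong (_↑ˡ suc H.order-1)))
      (t (inj₁ i) Fin.≟ t (inj₁ j)) (G.terminal i Fin.≟ G.terminal j))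
    (sym (entry-matrix (coincide G) i j))
  go (inj₂ i) (inj₂ j) = trans
    (does-⇔ (mk⇔ (↑ʳ-injective (suc G.order-1) _ _) (cong (suc G.order-1 ↑ʳ_)))
      (t (inj₂ i) Fin.≟ t (inj₂ j)) (H.terminal i Fin.≟ H.terminal j))
    (sym (entry-matrix (coincide H) i j))
  go (inj₁ i) (inj₂ j) =
    dec-false (t (inj₁ i) Fin.≟ t (inj₂ j)) (left≢right (G.terminal i) (H.terminal j))
  go (inj₂ i) (inj₁ j) =
    dec-false (t (inj₂ i) Fin.≟ t (inj₁ j)) (left≢right (G.terminal j) (H.terminal i) ∘ sym)

redefineᵐ : (Fin n → Fin m) → Matrix m → Matrix n
redefineᵐ σ M = matrix λ i j → entry M (σ i) (σ j)

coincidence-redefine : (σ : Fin n → Fin m) (G : TypedGraph m) →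
                       coincidence (redefine σ G) ≡ redefineᵐ σ (coincidence G)
coincidence-redefine σ G = matrix-cong λ i j → sym (entry-matrix (coincide G) (σ i) (σ j))

-- Adding the pair of `a` and `b` to an equivalence relation: a chain linking `i` to `j` can be
-- shortened until it uses the new pair at most once, in one of two directions. The disjuncts are
-- those of `separates`.
fuseᵐ : Fin n → Fin n → Matrix n → Matrix n
fuseᵐ a b M = matrix λ i j →
  entry M i j ∨ (entry M i a ∧ entry M j b ∨ entry M i b ∧ entry M j a)

coincidence-fuse : (a b : Fin n) (G : TypedGraph n) →
                   coincidence (fuse a b G) ≡ fuseᵐ a b (coincidence G)
coincidence-fuse a b G = matrix-cong λ i j → trans
  (does-⇔ (mk⇔ (separates (t i) (t j)) (merge i j)) (π (t i) Fin.≟ π (t j))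
    (t i Fin.≟ t j ⊎-dec (t i Fin.≟ t a ×-dec t j Fin.≟ t b ⊎-dec
                          t i Fin.≟ t b ×-dec t j Fin.≟ t a)))
  (sym (cong₂ _∨_ (e i j) (cong₂ _∨_ (cong₂ _∧_ (e i a) (e j b)) (cong₂ _∧_ (e i b) (e j a)))))
  where
  open Fusion a b G
  t = TypedGraph.terminal G
  e = entry-matrix (coincide G)
  merge : ∀ i j → t i ≡ t j ⊎ (t i ≡ t a × t j ≡ t b) ⊎ (t i ≡ t b × t j ≡ t a) →
          π (t i) ≡ π (t j)
  merge i j (inj₁ eq)                  = cong π eq
  merge i j (inj₂ (inj₁ (eq₁ , eq₂))) = trans (cong π eq₁) (trans identifies (cong π (sym eq₂)))
  merge i j (inj₂ (inj₂ (eq₁ , eq₂))) =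
    trans (cong π eq₁) (trans (sym identifies) (cong π (sym eq₂)))

-- Residues and the recogniser for cardinalities

toℕ-mod : ∀ m p .{{_ : NonZero p}} → toℕ (m mod p) ≡ m % p
toℕ-mod m p = Fin.toℕ-fromℕ< (m%n<n m p)

mod-cong : ∀ {m n} p .{{_ : NonZero p}} → m % p ≡ n % p → m mod p ≡ n mod p
mod-cong {m} {n} p eq = Fin.toℕ-injective (trans (toℕ-mod m p) (trans eq (sym (toℕ-mod n p))))

module _ (p : ℕ) .{{_ : NonZero p}} (r : ℕ) where

  _+ₚ_ : Fin p → Fin p → Fin p
  x +ₚ y = (toℕ x + toℕ y) mod p

  mod-+ : ∀ m n → (m + n) mod p ≡ (m mod p) +ₚ (n mod p)
  mod-+ m n = mod-cong p (trans (%-distribˡ-+ m n p)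
    (cong₂ (λ x y → (x + y) % p) (sym (toℕ-mod m p)) (sym (toℕ-mod n p))))

  -- Adding `p - 1` subtracts one modulo `p`, with no special case at residue zero.
  predₚ : Fin p → Fin p
  predₚ x = (toℕ x + pred p) mod p

  predₚ-mod-suc : ∀ m → predₚ (suc m mod p) ≡ m mod p
  predₚ-mod-suc m = mod-cong p (begin
    (toℕ (suc m mod p) + pred p) % p        ≡⟨ cong (λ x → (x + pred p) % p) (toℕ-mod (suc m) p) ⟩
    (suc m % p + pred p) % p                ≡⟨ %-distribˡ-+ (suc m % p) (pred p) p ⟩
    (suc m % p % p + pred p % p) % p
      ≡⟨ cong (λ x → (x + pred p % p) % p) (m%n%n≡m%n (suc m) p) ⟩
    (suc m % p + pred p % p) % p            ≡⟨ %-distribˡ-+ (suc m) (pred p) p ⟨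
    (suc m + pred p) % p                    ≡⟨ cong (_% p) (ℕ.+-suc m (pred p)) ⟨
    (m + suc (pred p)) % p                  ≡⟨ cong (λ q → (m + q) % p) (ℕ.suc-pred p) ⟩
    (m + p) % p                             ≡⟨ [m+n]%n≡m%n m p ⟩
    m % p                                   ∎)
    where open ≡-Reasoning

  private
    State : ℕ → Set
    State n = Fin p × Vec Bool n × Matrix n

    value : (G : TypedGraph n) → Colouring K (graph G) → K → State n
    value G c κ = cardinality (graph G) (c κ) mod p , terminalColours G (c κ) , coincidence G

    -- The first Boolean tells whether the terminals already coincide, the second whether the first
    -- of them is in the set. A set pulled back from the fusion contains both or neither, so one
    -- membership bit is enough.
    fuse-residue : Bool → Bool → Fin p → Fin p
    fuse-residue false true = predₚ
    fuse-residue _     _    = id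

    -- Here `P` is the coincidence of the two terminals, and `k` and `l` are the cardinalities
    -- before and after the fusion.
    fuse-residue-correct : {P : Set} (P? : Dec P) (x : Bool) {k l : ℕ} →
                           (P → k ≡ l) → (¬ P → k ≡ weight x + l) →
                           l mod p ≡ fuse-residue (does P?) x (k mod p)
    fuse-residue-correct (yes q) x     same drop rewrite same q = refl
    fuse-residue-correct (no ¬q) false same drop rewrite drop ¬q = refl
    fuse-residue-correct (no ¬q) true {l = l} same drop rewrite drop ¬q = sym (predₚ-mod-suc l)

  abstract

    -- Fusing distinct terminals loses one element of a set that contains them, hence the
    -- states record which terminals belong to the set and which of them coincide.
    cardᴿ : K → Recogniser K
    cardᴿ κ = record
      { State          = State
      ; finite         = λ n → finite-× finite-Fin
          (finite-× (finite-Vec finite-Bool n) (finite-Vec (finite-Vec finite-Bool n) n))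
      -- `Card` admits `r = p`, so the residue is compared with `r % p`.
      ; accept         = λ (x , _) → does (toℕ x ℕ.≟ r % p)
      ; value          = λ G c → value G c κ
      ; value-cong     = λ φ {c} {d} c≈d → cong₂ _,_
          (cong (_mod p) (cardinality-iso φ {c κ} {d κ} (c≈d κ)))
          (cong₂ _,_
            (tabulate-cong λ i → trans (c≈d κ _) (cong (d κ ∘ inj₁) (_≅_.terminals φ i)))
            (matrix-cong (coincide-iso φ)))
      ; ⊕ˢ             = λ (x , u , M) (y , w , N) → x +ₚ y , u ⊕ᵗ w , M ⊕ᵐ N
      ; value-⊕        = λ G H c → cong₂ _,_
          (trans (cong (_mod p) (cardinality-⊕ G H (c κ)))
            (mod-+ (cardinality (graph G) ((c ∘ᶜ left G H) κ)) _))
          (cong₂ _,_ (terminalColours-⊕ G H (c κ)) (coincidence-⊕ G H))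
      ; redefineˢ      = λ σ (x , u , M) → x , tabulate (lookup u ∘ σ) , redefineᵐ σ M
      ; value-redefine = λ σ G c → cong (_ ,_) (cong₂ _,_
          (tabulate-cong λ i → sym (lookup∘tabulate _ (σ i))) (coincidence-redefine σ G))
      ; fuseˢ          = λ a b (x , u , M) →
          fuse-residue (entry M a b) (lookup u a) x , u , fuseᵐ a b M
      ; value-fuse     = λ a b G c → cong₂ _,_
          (trans (fuse-residue-correct (TypedGraph.terminal G a Fin.≟ TypedGraph.terminal G b) _
                   (cardinality-fuse-≡ a b G (c κ)) (cardinality-fuse-≢ a b G (c κ)))
            (cong₂ (λ x y → fuse-residue x y
                                (cardinality (graph G) ((c ∘ᶜ quotient a b G) κ) mod p))
              (sym (entry-matrix (coincide G) a b)) (sym (lookup∘tabulate _ a))))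
          (cong (terminalColours G ((c ∘ᶜ quotient a b G) κ) ,_) (coincidence-fuse a b G))
      }

    accepts-card : (κ : K) (G : TypedGraph n) (c : Colouring K (graph G)) →
                   Accepts (cardᴿ κ) G c ⇔ (cardinality (graph G) (c κ) % p ≡ r % p)
    accepts-card κ G c = mk⇔
      (λ acc → trans (sym (toℕ-mod (cardinality (graph G) (c κ)) p)) (does⇒ (_ ℕ.≟ _) acc))
      (λ eq → dec-true (_ ℕ.≟ _) (trans (toℕ-mod (cardinality (graph G) (c κ)) p) eq))

-- Local tests

∧-true : ∀ x {y} → x ∧ y ≡ true ⇔ (x ≡ true × y ≡ true)
∧-true true  = mk⇔ (refl ,_) proj₂
∧-true false = mk⇔ (λ ()) (λ ())

vertexTest : K → LocalTest K
vertexTest κ = record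
  { test    = λ { Γ c (inj₁ v) → c κ (inj₁ v) ; Γ c (inj₂ e) → false }
  ; natural = λ { f c≈d (inj₁ v) → c≈d κ (inj₁ v) ; f c≈d (inj₂ e) → refl } }

edgeTest : K → LocalTest K
edgeTest κ = record
  { test    = λ { Γ c (inj₁ v) → false ; Γ c (inj₂ e) → c κ (inj₂ e) }
  ; natural = λ { f c≈d (inj₁ v) → refl ; f c≈d (inj₂ e) → c≈d κ (inj₂ e) } }

bothTest : K → K → LocalTest K
bothTest κ μ = record
  { test    = λ Γ c z → c κ z ∧ c μ z
  ; natural = λ f c≈d z → cong₂ _∧_ (c≈d κ z) (c≈d μ z) }

differenceTest : K → K → LocalTest K
differenceTest κ μ = record
  { test    = λ Γ c z → c κ z ∧ not (c μ z)
  ; natural = λ f c≈d z → cong₂ _∧_ (c≈d κ z) (cong not (c≈d μ z)) }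

matches : (Γ : Graph) → Colouring K Γ → List (Graph.V Γ) → Vec K m → Bool
matches Γ c []       []       = true
matches Γ c (v ∷ vs) (κ ∷ κs) = c κ (inj₁ v) ∧ matches Γ c vs κs
matches Γ c _        _        = false

matches-natural : (f : Hom Γ Δ) {c : Colouring K Γ} {d : Colouring K Δ} → Preserves f c d →
                  ∀ vs (κs : Vec K m) → matches Γ c vs κs ≡ matches Δ d (List.map (Hom.onV f) vs) κs
matches-natural f c≈d []       []       = refl
matches-natural f c≈d []       (_ ∷ _)  = refl
matches-natural f c≈d (_ ∷ _)  []       = refl
matches-natural f c≈d (v ∷ vs) (κ ∷ κs) =
  cong₂ _∧_ (c≈d κ (inj₁ v)) (matches-natural f c≈d vs κs)

-- Incidence becomes a property of a single edge: each end point must carry the prescribed colour.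
-- Morphisms map words to words and the colours are pulled back, so even a fusion does not change
-- the outcome.
connTest : K → Vec K m → LocalTest K
connTest κ κs = record
  { test    = λ { Γ c (inj₁ v) → false
                ; Γ c (inj₂ e) → c κ (inj₂ e) ∧ matches Γ c (toList (Graph.⟨_⟩ Γ e)) κs }
  ; natural = λ { f c≈d (inj₁ v) → refl
                ; {Γ} {Δ} f {d = d} c≈d (inj₂ e) → cong₂ _∧_ (c≈d κ (inj₂ e))
                    (trans (matches-natural f c≈d (toList (Graph.⟨_⟩ Γ e)) κs)
                           (cong (λ w → matches Δ d (toList w) κs) (Hom.words f e))) } }

module _ (G : TypedGraph n) (c : Colouring K (graph G)) where

  accepts-vertex : ∀ κ → Accepts (someᴿ (vertexTest κ)) G c ⇔ (∃[ v ] c κ (inj₁ v) ≡ true)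
  accepts-vertex κ = ⇔-trans (accepts-some (vertexTest κ) G c)
    (mk⇔ (λ { (inj₁ v , p) → v , p }) (λ (v , p) → inj₁ v , p))

  accepts-edge : ∀ κ → Accepts (someᴿ (edgeTest κ)) G c ⇔ (∃[ e ] c κ (inj₂ e) ≡ true)
  accepts-edge κ = ⇔-trans (accepts-some (edgeTest κ) G c)
    (mk⇔ (λ { (inj₂ e , p) → e , p }) (λ (e , p) → inj₂ e , p))

  accepts-both : ∀ κ μ → Accepts (someᴿ (bothTest κ μ)) G c ⇔
                         (∃[ z ] c κ z ≡ true × c μ z ≡ true)
  accepts-both κ μ = ⇔-trans (accepts-some (bothTest κ μ) G c)
    (mk⇔ (λ (z , p) → z , to (∧-true (c κ z)) p) (λ (z , p) → z , from (∧-true (c κ z)) p))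

  accepts-difference : ∀ κ μ → Accepts (someᴿ (differenceTest κ μ)) G c ⇔
                               (∃[ z ] c κ z ≡ true × c μ z ≡ false)
  accepts-difference κ μ = ⇔-trans (accepts-some (differenceTest κ μ) G c) (mk⇔
    (λ (z , p) → let p₁ , p₂ = to (∧-true (c κ z)) p in z , p₁ , not-injective p₂)
    (λ (z , p₁ , p₂) → z , from (∧-true (c κ z)) (p₁ , cong not p₂)))

  accepts-conn : ∀ κ (κs : Vec K m) → Accepts (someᴿ (connTest κ κs)) G c ⇔
    (∃[ e ] c κ (inj₂ e) ≡ true × matches (graph G) c (toList (TypedGraph.⟨_⟩ G e)) κs ≡ true)
  accepts-conn κ κs = ⇔-trans (accepts-some (connTest κ κs) G c) (mk⇔
    (λ { (inj₂ e , p) → e , to (∧-true (c κ (inj₂ e))) p })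
    (λ (e , p) → inj₂ e , from (∧-true (c κ (inj₂ e))) p))

-- Valuations as colourings

module _ (Γ : Graph) where
  open Ω Γ

  _≟ᴱ_ : (x y : Element) → Dec (x ≡ y)
  _≟ᴱ_ = ≡-dec Fin._≟_ Fin._≟_

  indicator : Element → Colour Γ
  indicator x z = does (x ≟ᴱ z)

  indicator⇔ : ∀ x z → indicator x z ≡ true ⇔ x ≡ z
  indicator⇔ x z = does⇔ (x ≟ᴱ z)

  member : SetElement → Colour Γ
  member (inj₁ X) (inj₁ v) = lookup X v
  member (inj₂ X) (inj₂ e) = lookup X e
  member _        _        = false

  member⇔ : ∀ X z → member X z ≡ true ⇔ z ∈ X
  member⇔ (inj₁ X) (inj₁ v) = mk⇔ (lookup⇒[]= v X) []=⇒lookup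
  member⇔ (inj₂ X) (inj₂ e) = mk⇔ (lookup⇒[]= e X) []=⇒lookup
  member⇔ (inj₁ X) (inj₂ e) = mk⇔ (λ ()) (λ ())
  member⇔ (inj₂ X) (inj₁ v) = mk⇔ (λ ()) (λ ())

  valuation : Vec Element i → Vec SetElement j → Colouring (Fin i ⊎ Fin j) Γ
  valuation ρ σ = [ indicator ∘ lookup ρ , member ∘ lookup σ ]′

  sum-weight : ∀ {k} (X : Subset k) → sum (weight ∘ lookup X) ≡ ∣ X ∣
  sum-weight []          = refl
  sum-weight (true  ∷ X) = cong suc (sum-weight X)
  sum-weight (false ∷ X) = sum-weight X

  cardinality-member : ∀ X → cardinality Γ (member X) ≡ card X
  cardinality-member (inj₁ X) = trans
    (cong₂ _+_ (sum-weight X) (sum-replicate-zero (Graph.size Γ))) (ℕ.+-identityʳ ∣ X ∣)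
  cardinality-member (inj₂ X) =
    cong₂ _+_ (sum-replicate-zero (suc (Graph.order-1 Γ))) (sum-weight X)

  matches-valuation : (ρ : Vec Element i) (σ : Vec SetElement j) →
    ∀ vs (xs : Vec (Fin i) m) →
    matches Γ (valuation ρ σ) vs (Vec.map inj₁ xs) ≡ true ⇔
    List.map inj₁ vs ≡ Vec.toList (Vec.map (lookup ρ) xs)
  matches-valuation ρ σ []       []       = mk⇔ (λ _ → refl) (λ _ → refl)
  matches-valuation ρ σ []       (_ ∷ _)  = mk⇔ (λ ()) (λ ())
  matches-valuation ρ σ (_ ∷ _)  []       = mk⇔ (λ ()) (λ ())
  matches-valuation ρ σ (v ∷ vs) (x ∷ xs) =
    ⇔-trans (∧-true (indicator (lookup ρ x) (inj₁ v))) (⇔-trans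
    (indicator⇔ (lookup ρ x) (inj₁ v) ×-⇔ matches-valuation ρ σ vs xs)
    (mk⇔ (λ (p , q) → cong₂ _∷_ (sym p) q)
         (λ eq → sym (List.∷-injectiveˡ eq) , List.∷-injectiveʳ eq)))

-- Recognising singletons and unmixed sets

splitᴿ : K → Recogniser (Maybe K)
splitᴿ κ = andᴿ (someᴿ (bothTest (just κ) nothing)) (someᴿ (differenceTest (just κ) nothing))

-- A nonempty set is a singleton if no set splits it.
singletonᴿ : K → Recogniser K
singletonᴿ κ = andᴿ (someᴿ (bothTest κ κ)) (allᴿ (notᴿ (splitᴿ κ)))

module _ (κ : K) (G : TypedGraph n) (c : Colouring K (graph G)) where

  Split-by : Colour (graph G) → Set
  Split-by f = (∃[ z ] c κ z ≡ true × f z ≡ true) × (∃[ z ] c κ z ≡ true × f z ≡ false)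

  accepts-split : ∀ f → Accepts (splitᴿ κ) G (f ▹ c) ⇔ Split-by f
  accepts-split f = ⇔-trans (accepts-and _ _ G (f ▹ c))
    (accepts-both G (f ▹ c) (just κ) nothing ×-⇔ accepts-difference G (f ▹ c) (just κ) nothing)

  accepts-unsplit : Accepts (allᴿ (notᴿ (splitᴿ κ))) G c ⇔ (∀ f → ¬ Split-by f)
  accepts-unsplit = ⇔-trans (accepts-all (notᴿ (splitᴿ κ)) G c) (mk⇔
    (λ acc f s → to (accepts-not (splitᴿ κ) G (f ▹ c)) (acc f) (from (accepts-split f) s))
    (λ ¬s f → from (accepts-not (splitᴿ κ) G (f ▹ c)) λ acc → ¬s f (to (accepts-split f) acc)))

  -- It suffices to try the indicator of one element `x` of the set as a splitting set: any further
  -- element would lie outside it. Conversely, two elements of a singleton are equal, so no colour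
  -- distinguishes them.
  accepts-singleton : Accepts (singletonᴿ κ) G c ⇔ (∃[ x ] c κ ≗ indicator (graph G) x)
  accepts-singleton = ⇔-trans (accepts-and _ _ G c)
    (⇔-trans (accepts-both G c κ κ ×-⇔ accepts-unsplit) (mk⇔ sound complete))
    where
    sound : (∃[ z ] c κ z ≡ true × c κ z ≡ true) × (∀ f → ¬ Split-by f) →
            ∃[ x ] c κ ≗ indicator (graph G) x
    sound ((x , x∈ , _) , unsplit) = x , λ z → only z (_≟ᴱ_ (graph G) x z) (c κ z) refl
      where
      only : ∀ z (x≟z : Dec (x ≡ z)) b → c κ z ≡ b → b ≡ does x≟z
      only z (yes refl) b     eq = trans (sym eq) x∈
      only z (no _)     false eq = refl
      only z (no x≢z)   true  eq = contradiction
        ( (x , x∈ , dec-true (_≟ᴱ_ (graph G) x x) refl)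
        , (z , eq , dec-false (_≟ᴱ_ (graph G) x z) x≢z))
        (unsplit (indicator (graph G) x))

    complete : (∃[ x ] c κ ≗ indicator (graph G) x) →
               (∃[ z ] c κ z ≡ true × c κ z ≡ true) × (∀ f → ¬ Split-by f)
    complete (x , c≗x) = (x , x∈ , x∈) , λ { f ((y , y∈ , fy) , (z , z∈ , ¬fz)) →
      contradiction (trans (sym fy)
        (trans (cong f (trans (sym (only y y∈)) (only z z∈))) ¬fz)) λ () }
      where
      x∈ : c κ x ≡ true
      x∈ = trans (c≗x x) (dec-true (_≟ᴱ_ (graph G) x x) refl)
      only : ∀ y → c κ y ≡ true → x ≡ y
      only y y∈ = to (indicator⇔ (graph G) x y) (trans (sym (c≗x y)) y∈)

homogeneousᴿ : K → Recogniser K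
homogeneousᴿ κ = notᴿ (andᴿ (someᴿ (vertexTest κ)) (someᴿ (edgeTest κ)))

accepts-homogeneous : (κ : K) (G : TypedGraph n) (c : Colouring K (graph G)) →
                      Accepts (homogeneousᴿ κ) G c ⇔ (∃[ X ] c κ ≗ member (graph G) X)
accepts-homogeneous κ G c = mk⇔
  (λ acc → sound (to (accepts-not (andᴿ vs es) G c) acc))
  (λ X → from (accepts-not (andᴿ vs es) G c) λ acc →
     let p , q = to (accepts-and vs es G c) acc
     in complete X (to (accepts-vertex G c κ) p) (to (accepts-edge G c κ) q))
  where
  vs = someᴿ (vertexTest κ)
  es = someᴿ (edgeTest κ)

  sound : ¬ Accepts (andᴿ vs es) G c → ∃[ X ] c κ ≗ member (graph G) X
  sound ¬both with accepts? vs G c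
  ... | yes p = inj₁ (tabulate (c κ ∘ inj₁)) ,
    λ { (inj₁ v) → sym (lookup∘tabulate (c κ ∘ inj₁) v)
      ; (inj₂ e) → ¬-not λ eq →
          ¬both (from (accepts-and vs es G c) (p , from (accepts-edge G c κ) (e , eq))) }
  -- A colour without vertices is coded as a set of edges; this includes the empty colour, which has
  -- a code on either side.
  ... | no ¬p = inj₂ (tabulate (c κ ∘ inj₂)) ,
    λ { (inj₁ v) → ¬-not λ eq → ¬p (from (accepts-vertex G c κ) (v , eq))
      ; (inj₂ e) → sym (lookup∘tabulate (c κ ∘ inj₂) e) }

  complete : (∃[ X ] c κ ≗ member (graph G) X) →
             (∃[ v ] c κ (inj₁ v) ≡ true) → (∃[ e ] c κ (inj₂ e) ≡ true) → ⊥
  complete (inj₁ X , c≗X) _ (e , p) with () ← trans (sym (c≗X (inj₂ e))) p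
  complete (inj₂ X , c≗X) (v , p) _ with () ← trans (sym (c≗X (inj₁ v))) p

-- Relativised quantification: if the colours accepted by the guard `R` are, up to pointwise
-- equality, those coded by `A`, then quantifying over colours under `R` is quantifying over `A`.
-- Both quantifiers of the logic are instances.
accepts-guarded : (R S : Recogniser (Maybe K)) (G : TypedGraph n) (c : Colouring K (graph G))
  {A : Set} {code : A → Colour (graph G)} →
  (∀ f → Accepts R G (f ▹ c) ⇔ (∃[ a ] f ≗ code a)) →
  Accepts (allᴿ (impliesᴿ R S)) G c ⇔ (∀ a → Accepts S G (code a ▹ c))
accepts-guarded R S G c {code = code} guard = mk⇔
  (λ acc a → to (accepts-implies R S G (code a ▹ c))
               (to (accepts-all (impliesᴿ R S) G c) acc (code a))
               (from (guard (code a)) (a , λ _ → refl)))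
  (λ all → from (accepts-all (impliesᴿ R S) G c) λ f → from (accepts-implies R S G (f ▹ c)) λ ok →
     let a , f≗a = to (guard f) ok
     in Accepts-≗ S G (λ { nothing z → sym (f≗a z) ; (just κ) _ → refl }) (all a))

-- Translation of formulas

-- Variables of both kinds are names of colours, so either binder becomes the quantification of
-- `nothing`, once its variable zero is renamed to that.
bind-ind : Fin (suc i) ⊎ Fin j → Maybe (Fin i ⊎ Fin j)
bind-ind (inj₁ zero)    = nothing
bind-ind (inj₁ (suc x)) = just (inj₁ x)
bind-ind (inj₂ X)       = just (inj₂ X)

bind-set : Fin i ⊎ Fin (suc j) → Maybe (Fin i ⊎ Fin j)
bind-set (inj₁ x)       = just (inj₁ x)
bind-set (inj₂ zero)    = nothing
bind-set (inj₂ (suc X)) = just (inj₂ X)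

-- Equality and membership both become nonempty intersection. This is faithful because individual
-- variables denote singletons: `valuation` assigns indicators to them, and the guard `singletonᴿ`
-- keeps this true under quantifiers.
recogniser : Formula i j → Recogniser (Fin i ⊎ Fin j)
recogniser (vert x)       = someᴿ (vertexTest (inj₁ x))
recogniser (edge x)       = someᴿ (edgeTest (inj₁ x))
recogniser (x ≐ y)        = someᴿ (bothTest (inj₁ x) (inj₁ y))
recogniser (X ∋ x)        = someᴿ (bothTest (inj₁ x) (inj₂ X))
recogniser (conn m y xs)  = someᴿ (connTest (inj₁ y) (Vec.map inj₁ xs))
recogniser (Card p r _ X) = cardᴿ p r (inj₂ X)
recogniser (¬′ φ)         = notᴿ (recogniser φ)
recogniser (φ ∧′ ψ)       = andᴿ (recogniser φ) (recogniser ψ)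
recogniser (∀-ind φ)      = allᴿ (impliesᴿ (singletonᴿ nothing) (rename bind-ind (recogniser φ)))
recogniser (∀-set φ)      = allᴿ (impliesᴿ (homogeneousᴿ nothing) (rename bind-set (recogniser φ)))

recogniser-correct : (φ : Formula i j) (G : TypedGraph n) → let open Ω (graph G) in
  (ρ : Vec Element i) (σ : Vec SetElement j) →
  Accepts (recogniser φ) G (valuation (graph G) ρ σ) ⇔ Sat φ ρ σ
recogniser-correct (vert x) G ρ σ = ⇔-trans
  (accepts-vertex G (valuation (graph G) ρ σ) (inj₁ x))
  (mk⇔ (λ (v , p) → v , to (indicator⇔ (graph G) (lookup ρ x) (inj₁ v)) p)
       (λ (v , eq) → v , from (indicator⇔ (graph G) (lookup ρ x) (inj₁ v)) eq))
recogniser-correct (edge x) G ρ σ = ⇔-trans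
  (accepts-edge G (valuation (graph G) ρ σ) (inj₁ x))
  (mk⇔ (λ (e , p) → e , to (indicator⇔ (graph G) (lookup ρ x) (inj₂ e)) p)
       (λ (e , eq) → e , from (indicator⇔ (graph G) (lookup ρ x) (inj₂ e)) eq))
recogniser-correct (x ≐ y) G ρ σ = ⇔-trans
  (accepts-both G (valuation (graph G) ρ σ) (inj₁ x) (inj₁ y))
  (mk⇔ (λ (z , px , py) → trans (to (indicator⇔ (graph G) (lookup ρ x) z) px)
                                (sym (to (indicator⇔ (graph G) (lookup ρ y) z) py)))
       (λ eq → lookup ρ y , from (indicator⇔ (graph G) (lookup ρ x) (lookup ρ y)) eq
                          , from (indicator⇔ (graph G) (lookup ρ y) (lookup ρ y)) refl))
recogniser-correct (X ∋ x) G ρ σ = ⇔-trans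
  (accepts-both G (valuation (graph G) ρ σ) (inj₁ x) (inj₂ X))
  (mk⇔ (λ (z , px , pX) → subst (λ z → Ω._∈_ (graph G) z (lookup σ X))
          (sym (to (indicator⇔ (graph G) (lookup ρ x) z) px))
          (to (member⇔ (graph G) (lookup σ X) z) pX))
       (λ x∈X → lookup ρ x , from (indicator⇔ (graph G) (lookup ρ x) (lookup ρ x)) refl
                           , from (member⇔ (graph G) (lookup σ X) (lookup ρ x)) x∈X))
recogniser-correct (conn m y xs) G ρ σ = ⇔-trans
  (accepts-conn G (valuation (graph G) ρ σ) (inj₁ y) (Vec.map inj₁ xs))
  (mk⇔ (λ (e , p) → e , to (step e) p) (λ (e , p) → e , from (step e) p))
  where
  step = λ e → indicator⇔ (graph G) (lookup ρ y) (inj₂ e) ×-⇔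
               matches-valuation (graph G) ρ σ (toList (TypedGraph.⟨_⟩ G e)) xs
recogniser-correct (Card p r _ X) G ρ σ =
  subst (λ k → Accepts (cardᴿ p r (inj₂ X)) G (valuation (graph G) ρ σ) ⇔ k % p ≡ r % p)
    (cardinality-member (graph G) (lookup σ X))
    (accepts-card p r (inj₂ X) G (valuation (graph G) ρ σ))
recogniser-correct (¬′ φ) G ρ σ = ⇔-trans (accepts-not (recogniser φ) G (valuation (graph G) ρ σ))
  (mk⇔ (_∘ from (recogniser-correct φ G ρ σ)) (_∘ to (recogniser-correct φ G ρ σ)))
recogniser-correct (φ ∧′ ψ) G ρ σ = ⇔-trans
  (accepts-and (recogniser φ) (recogniser ψ) G (valuation (graph G) ρ σ))
  (recogniser-correct φ G ρ σ ×-⇔ recogniser-correct ψ G ρ σ)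
recogniser-correct {i} {j} (∀-ind φ) G ρ σ = ⇔-trans
  (accepts-guarded (singletonᴿ nothing) (rename bind-ind (recogniser φ)) G (valuation (graph G) ρ σ)
    (λ f → accepts-singleton nothing G (f ▹ valuation (graph G) ρ σ)))
  (mk⇔ (λ acc x → to (recogniser-correct φ G (x ∷ ρ) σ)
                     (Accepts-≗ (recogniser φ) G (agree x) (acc x)))
       (λ sat x → Accepts-≗ (recogniser φ) G (λ κ z → sym (agree x κ z))
                     (from (recogniser-correct φ G (x ∷ ρ) σ) (sat x))))
  where
  agree : ∀ x (κ : Fin (suc i) ⊎ Fin j) →
          (indicator (graph G) x ▹ valuation (graph G) ρ σ) (bind-ind κ) ≗
          valuation (graph G) (x ∷ ρ) σ κ
  agree x (inj₁ zero)    z = refl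
  agree x (inj₁ (suc _)) z = refl
  agree x (inj₂ _)       z = refl
recogniser-correct {i} {j} (∀-set φ) G ρ σ = ⇔-trans
  (accepts-guarded (homogeneousᴿ nothing) (rename bind-set (recogniser φ)) G
    (valuation (graph G) ρ σ)
    (λ f → accepts-homogeneous nothing G (f ▹ valuation (graph G) ρ σ)))
  (mk⇔ (λ acc X → to (recogniser-correct φ G ρ (X ∷ σ))
                     (Accepts-≗ (recogniser φ) G (agree X) (acc X)))
       (λ sat X → Accepts-≗ (recogniser φ) G (λ κ z → sym (agree X κ z))
                     (from (recogniser-correct φ G ρ (X ∷ σ)) (sat X))))
  where
  agree : ∀ X (κ : Fin i ⊎ Fin (suc j)) →
          (member (graph G) X ▹ valuation (graph G) ρ σ) (bind-set κ) ≗
          valuation (graph G) ρ (X ∷ σ) κ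
  agree X (inj₁ _)       z = refl
  agree X (inj₂ zero)    z = refl
  agree X (inj₂ (suc _)) z = refl

-- The algebra of states

module _ (R : Recogniser (Fin 0 ⊎ Fin 0)) where
  open Recogniser R hiding (Accepts; Accepts-≗)

  private
    uncoloured : (Γ : Graph) → Colouring (Fin 0 ⊎ Fin 0) Γ
    uncoloured Γ = valuation Γ [] []

    h : TypedGraph n → State n
    h G = value G (uncoloured (graph G))

    -- Without colour names any two colourings agree pointwise, though a restricted one is not
    -- literally `uncoloured`. This identifies the states of the parts in the sum and fusion cases
    -- of `evaluation`.
    value-uncoloured : (G : TypedGraph n) (c : Colouring (Fin 0 ⊎ Fin 0) (graph G)) →
                       value G c ≡ h G
    value-uncoloured G c = value-≗ G λ { (inj₁ ()) ; (inj₂ ()) }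

  stateOp : (g : GraphSymbol) → Tuple (setoid ∘ State) (graphInputs g) → State (graphOutput g)
  stateOp (sumₛ _ _)    (x ∷ y ∷ []) = ⊕ˢ x y
  stateOp (redefineₛ σ) (x ∷ [])     = redefineˢ σ x
  stateOp (fuseₛ a b)   (x ∷ [])     = fuseˢ a b x
  stateOp vertexₛ       []           = h 𝔳
  stateOp (edgeₛ k)     []           = h (𝔢 k)

  states : Algebra graphSignature _ _
  states = record
    { carrier = setoid ∘ State ; op = stateOp ; op-cong = λ g r → cong (stateOp g) (≡-tuple r) }
    where
    ≡-tuple : ∀ {ts} {xs ys : Tuple (setoid ∘ State) ts} →
              Pointwise (setoid ∘ State) xs ys → xs ≡ ys
    ≡-tuple {xs = []}    {[]}    _          = refl
    ≡-tuple {xs = _ ∷ _} {_ ∷ _} (refl , r) = cong (_ ∷_) (≡-tuple r)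

  evaluation : Morphism 𝔊 states
  evaluation = record
    { hom      = λ n → record { to = h ; cong = λ φ → value-cong φ λ { (inj₁ ()) ; (inj₂ ()) } }
    ; commutes = λ where
        (sumₛ _ _)    (G ∷ H ∷ []) →
          trans (value-⊕ G H _) (cong₂ ⊕ˢ (value-uncoloured G _) (value-uncoloured H _))
        (redefineₛ σ) (G ∷ [])     → value-redefine σ G _
        (fuseₛ a b)   (G ∷ [])     →
          trans (value-fuse a b G _) (cong (fuseˢ a b) (value-uncoloured G _))
        vertexₛ       []           → refl
        (edgeₛ k)     []           → refl
    }

  recognisable : Recognisable 𝔊 n λ G → Accepts R G (uncoloured (graph G))
  recognisable = states , finite , evaluation , (λ x → accept x ≡ true) ,
    (λ { refl p → p }) , λ G → ⇔-refl

recognisable-sentence : (φ : Sentence) (n : ℕ) → Recognisable 𝔊 n λ G → ⊨Ω (graph G) φ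
recognisable-sentence φ n =
  let B , fin , h , M , resp , L⇔M = recognisable (recogniser φ) {n}
  in B , fin , h , M , resp , λ G → ⇔-trans (⇔-sym (recogniser-correct φ G [] [])) (L⇔M G)

theoremA5p2 : ∀ {p q : Level} (A : InheritedFrom 𝔊 p q) (φ : Sentence) (n : ℕ) →
    Recognisable (Subalgebra.algebra A) n (λ G → ⊨Ω (TypedGraph.graph (proj₁ G)) φ)
theoremA5p2 A φ n = recognisable-inherited A (recognisable-sentence φ n)
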